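{- Let $q$ be a prime power, let $n$ be a positive integer, and let $(d_1,\ldots,d_\ell)\in\mathbb{N}^\ell\cup\{(0,\ldots,0)\}$ be a symmetric Ferrers sequence. If $r=\partial(d_1,\ldots,d_\ell)$ is even, then $$q^{|\Xi\cap(d_1,\ldots,d_\ell)|}\,W_r(\mathrm{Alt}_q^{n\times n}[d_1,\ldots,d_\ell])=W_r(\mathrm{Sym}_q^{n\times n}[d_1,\ldots,d_\ell]).$$
   Context: A Ferrers diagram is a finite set $\mathcal{F}\subseteq\mathbb{N}\times\mathbb{N}$ ($\mathbb{N}$ the positive integers; $(i,j)$ = row $i$, column $j$) such that $(i,j)\in\mathcal{F}$ implies $(s,t)\in\mathcal{F}$ for all $1\le s\le i$, $1\le t\le j$; it is symmetric if $(i,j)\in\mathcal{F}$ implies $(j,i)\in\mathcal{F}$. The $i$-th diagonal is $\Delta_i=\{(s,i-s+1):1\le s\le i\}$ and $\Xi=\{(i,i):i\in\mathbb{N}\}$. A sequence $(d_1,\ldots,d_\ell)$ of non-negative integers is a Ferrers sequence if it is all zero or there is $r\in\{1,\ldots,\ell\}$ with $d_i=i$ for $i\le r$ and $d_r\ge\cdots\ge d_\ell$; it is a symmetric Ferrers sequence if moreover there exists $r\in\{1,\ldots,\ell\}$ such that $d_i$ is even whenever $i\in\{1,\ldots,r\}$ is even or $i\in\{r+1,\ldots,\ell\}$; such sequences are the diagonal sequences $(|\Delta_i\cap\mathcal{F}|)_{i\le\ell}$ of symmetric Ferrers diagrams $\mathcal{F}$ with no cells on diagonals beyond $\ell$. $\partial(d_1,\ldots,d_\ell)=\max_i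 d_i$ (the maximum size of a non-attacking rook placement, i.e. of a set of cells no two in the same row or column, in such an $\mathcal{F}$). A matrix over $\mathbb{F}_q$ is symmetric if $M_{ij}=M_{ji}$, alternating if $M_{ii}=0$ and $M_{ij}=-M_{ji}$. $W_r(\mathrm{Sym}_q^{n\times n}[d_1,\ldots,d_\ell])$ (resp. $W_r(\mathrm{Alt}_q^{n\times n}[d_1,\ldots,d_\ell])$) denotes the number of symmetric (resp. alternating) $n\times n$ matrices over $\mathbb{F}_q$ of rank $r$ with support $\{(i,j):M_{ij}\neq0\}$ contained in a symmetric Ferrers diagram $\mathcal{F}\subseteq\{1,\ldots,n\}^2$ with $|\Delta_i\cap\mathcal{F}|=d_i$ for $i\le\ell$ and $|\Delta_i\cap\mathcal{F}|=0$ for $i>\ell$ (the paper takes these numbers to depend only on the sequence). $|\Xi\cap(d_1,\ldots,d_\ell)|=|\Xi\cap\mathcal{F}|$, which equals the number of indices $i$ with $d_i$ odd. -}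

module Defs where

open import Data.Bool using (Bool; true; false; _∧_; if_then_else_)
open import Data.Nat using (ℕ; zero; suc; _^_; _≤_; _<_; _⊔_; _≡ᵇ_)
  renaming (_+_ to _+ℕ_)
open import Data.Nat.Divisibility using (_∣_)
open import Data.Nat.Primality using (Prime)
open import Data.Fin using (Fin; toℕ)
import Data.Fin as Fin
open import Data.Fin.Subset using (Subset; _∈_; _∉_; ∣_∣)
open import Data.Vec using (Vec; lookup; foldr)
open import Data.Product using (Σ; _×_)
open import Data.Sum using (_⊎_)
open import Data.List using (List; length)
import Data.List.Membership.Propositional as L
open import Data.List.Relation.Unary.Unique.Propositional using (Unique)
open import Relation.Binary.PropositionalEquality using (_≡_; _≢_)
open import Function.Bundles using (_↔_)
open import Algebra.Structures using (IsCommutativeRing)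

IsPrimePower : ℕ → Set
IsPrimePower q = Σ ℕ λ p → Σ ℕ λ k → Prime p × 1 ≤ k × q ≡ p ^ k

record FiniteField (q : ℕ) : Set₁ where
  infixl 7 _*_
  infixl 6 _+_
  field
    Carrier : Set
    _+_ : Carrier → Carrier → Carrier
    _*_ : Carrier → Carrier → Carrier
    -_  : Carrier → Carrier
    0#  : Carrier
    1#  : Carrier
    isCommutativeRing : IsCommutativeRing _≡_ _+_ _*_ -_ 0# 1#
    0≢1 : 0# ≢ 1#
    inverse : ∀ x → x ≢ 0# → Σ Carrier λ y → x * y ≡ 1#
    finite : Carrier ↔ Fin q

countᵇ : ∀ {m} → (Fin m → Bool) → ℕ
countᵇ {zero}  f = 0
countᵇ {suc m} f = (if f Fin.zero then 1 else 0) +ℕ countᵇ (λ i → f (Fin.suc i))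

sumℕ : ∀ {m} → (Fin m → ℕ) → ℕ
sumℕ {zero}  f = 0
sumℕ {suc m} f = f Fin.zero +ℕ sumℕ (λ i → f (Fin.suc i))

HasCount : {A : Set} → (A → Set) → ℕ → Set
HasCount {A} P N = Σ (List A) λ xs →
  Unique xs × (∀ x → (x L.∈ xs → P x) × (P x → x L.∈ xs)) × length xs ≡ N

-- Ferrers diagrams inside {1..n}×{1..n}.  Index i : Fin n stands for the
-- positive integer toℕ i +ℕ 1.  A diagram is a Boolean predicate on cells.

Diagram : ℕ → Set
Diagram n = Fin n → Fin n → Bool

IsFerrers : ∀ {n} → Diagram n → Set
IsFerrers {n} F = ∀ (i j s t : Fin n) → F i j ≡ true →
  toℕ s ≤ toℕ i → toℕ t ≤ toℕ j → F s t ≡ true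

IsSymmetricDiagram : ∀ {n} → Diagram n → Set
IsSymmetricDiagram F = ∀ i j → F i j ≡ true → F j i ≡ true

-- |Δ_{k+1} ∩ F|: the (k+1)-th diagonal consists of the 1-based cells (s,t)
-- with s + t = k + 2, i.e. 0-based cells (i,j) with toℕ i +ℕ toℕ j ≡ k.
diagSize : ∀ {n} → Diagram n → ℕ → ℕ
diagSize F k = sumℕ λ i → countᵇ λ j → F i j ∧ (toℕ i +ℕ toℕ j ≡ᵇ k)

diagCells : ∀ {n} → Diagram n → ℕ
diagCells F = countᵇ λ i → F i i

-- F has diagonal sequence (d_1,…,d_ℓ): entry d[k] (0-based) is d_{k+1};
-- |Δ_{k+1} ∩ F| = d_{k+1} for k < ℓ and F has no cells on Δ_i for i > ℓ.
HasDiagonalSequence : ∀ {n ℓ} → Diagram n → Vec ℕ ℓ → Set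
HasDiagonalSequence {n} {ℓ} F d =
  (∀ (k : Fin ℓ) → diagSize F (toℕ k) ≡ lookup d k) ×
  (∀ (i j : Fin n) → F i j ≡ true → toℕ i +ℕ toℕ j < ℓ)

-- Ferrers sequences (0-based index k represents the 1-based index k+1)

AllZero : ∀ {ℓ} → Vec ℕ ℓ → Set
AllZero {ℓ} d = ∀ (k : Fin ℓ) → lookup d k ≡ 0

IsFerrersSeq : ∀ {ℓ} → Vec ℕ ℓ → Set
IsFerrersSeq {ℓ} d = AllZero d ⊎ Σ (Fin ℓ) λ r →
  (∀ (i : Fin ℓ) → toℕ i ≤ toℕ r → lookup d i ≡ toℕ i +ℕ 1) ×
  (∀ (i j : Fin ℓ) → toℕ r ≤ toℕ i → toℕ i ≤ toℕ j → lookup d j ≤ lookup d i)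

Even : ℕ → Set
Even m = 2 ∣ m

IsSymmetricFerrersSeq : ∀ {ℓ} → Vec ℕ ℓ → Set
IsSymmetricFerrersSeq {ℓ} d = IsFerrersSeq d ×
  (AllZero d ⊎ Σ (Fin ℓ) λ r → ∀ (i : Fin ℓ) →
     ((toℕ i ≤ toℕ r × Even (toℕ i +ℕ 1)) ⊎ toℕ r < toℕ i) → Even (lookup d i))

∂ : ∀ {ℓ} → Vec ℕ ℓ → ℕ
∂ d = foldr _ _⊔_ 0 d

module Matrices {q : ℕ} (K : FiniteField q) where
  open FiniteField K

  Mat : ℕ → Set
  Mat n = Vec (Vec Carrier n) n

  _[_,_] : ∀ {n} → Mat n → Fin n → Fin n → Carrier
  M [ i , j ] = lookup (lookup M i) j

  Σ' : ∀ {m} → (Fin m → Carrier) → Carrier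
  Σ' {zero}  f = 0#
  Σ' {suc m} f = f Fin.zero + Σ' (λ j → f (Fin.suc j))

  IsSymmetricMat : ∀ {n} → Mat n → Set
  IsSymmetricMat M = ∀ i j → M [ i , j ] ≡ M [ j , i ]

  IsAlternatingMat : ∀ {n} → Mat n → Set
  IsAlternatingMat M = (∀ i → M [ i , i ] ≡ 0#) × (∀ i j → M [ i , j ] ≡ - (M [ j , i ]))

  SupportIn : ∀ {n} → Diagram n → Mat n → Set
  SupportIn F M = ∀ i j → M [ i , j ] ≢ 0# → F i j ≡ true

  LinIndepCols : ∀ {n} → Mat n → Subset n → Set
  LinIndepCols {n} M S = ∀ (c : Fin n → Carrier) →
    (∀ j → j ∉ S → c j ≡ 0#) →
    (∀ i → Σ' (λ j → M [ i , j ] * c j) ≡ 0#) →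
    ∀ j → c j ≡ 0#

  HasRank : ∀ {n} → Mat n → ℕ → Set
  HasRank M r = (Σ (Subset _) λ S → LinIndepCols M S × ∣ S ∣ ≡ r) ×
                (∀ S → LinIndepCols M S → ∣ S ∣ ≤ r)

  SymRankIn : ∀ {n} → Diagram n → ℕ → Mat n → Set
  SymRankIn F r M = IsSymmetricMat M × SupportIn F M × HasRank M r

  AltRankIn : ∀ {n} → Diagram n → ℕ → Mat n → Set
  AltRankIn F r M = IsAlternatingMat M × SupportIn F M × HasRank M r

{-# OPTIONS --safe #-}
-- Number rows and columns backwards, so that index 0 is the last one and F is closed under increasing
-- either index, and measure rank by the size q ^ c of the kernel, c being the corank.  Sort the
-- matrices by their column 0, v.  If v = 0, delete row and column 0.  If v₀ = 0 but vₚ ≠ 0, the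
-- congruence which clears rows and columns 0 and p preserves F, because every row i with vᵢ ≠ 0 is full;
-- it leaves a matrix of the same corank on the diagram without 0 and p, and forgets row p off the two
-- pivots together with its diagonal entry, which is arbitrary for symmetric and 0 for alternating
-- matrices.  So each such v contributes one factor q to the quotient of the two counts, as does the
-- diagonal cell (p, p) of F, and the theorem follows by induction unless (0, 0) ∈ F.  In that case F is
-- the full n×n square and r = n is even, and v₀ ≠ 0 occurs for symmetric matrices only.  The number G n of
-- invertible symmetric matrices then satisfies a two-term recursion, which gives
-- G (2t+1) = (q^(2t+1) - 1) G (2t) and G (2t+2) = q^(2t+2) G (2t+1), and the counts can be compared.
-- The even number r enters as r = a + b for a cell (a, b) ∉ F, so that F lies in the first a rows and the
-- first b columns; this property passes to the smaller diagrams.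
module Submission where

open import Data.Nat as ℕ using (ℕ)
open import Data.Product using (_×_; _,_)
import Relation.Binary.PropositionalEquality as ≡
open import Relation.Nullary using (yes; no)
open import Relation.Binary using (WeaklyDecidable)
open import Algebra.Bundles using (CommutativeRing; RawRing)
open import Level using (0ℓ)
open import Data.Maybe using (Maybe; just; nothing)
open import Algebra.Solver.Ring.AlmostCommutativeRing
  using (fromCommutativeRing; _-Raw-AlmostCommutative⟶_; Induced-equivalence)
import Algebra.Solver.Ring
import Algebra.Solver.Ring.NaturalCoefficients.Default
import Algebra.Properties.Ring
import Algebra.Properties.Semiring.Mult
import Relation.Binary.Reasoning.Setoid

-- A solver for identities in an abstract commutative ring

-- The library's ring solver only cancels x − x when equality of coefficients computes, which it does
-- not in an abstract ring; so coefficients are integers, given as formal differences of naturals.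
module CommutativeRingSolver (R : CommutativeRing 0ℓ 0ℓ) where
  open CommutativeRing R
  private
    open Algebra.Properties.Semiring.Mult semiring using (×-homo-+; ×1-homo-*) renaming (_×_ to _×ᵣ_)
    open Algebra.Properties.Ring ring using (-1*x≈-x)
    open Relation.Binary.Reasoning.Setoid setoid
    module N = Algebra.Solver.Ring.NaturalCoefficients.Default commutativeSemiring

    -- The first two clauses make the constants 0# and 1# definitionally values of coefficients.
    ⟦_⟧ : ℕ × ℕ → Carrier
    ⟦ 0 , 0 ⟧ = 0#
    ⟦ 1 , 0 ⟧ = 1#
    ⟦ a , b ⟧ = a ×ᵣ 1# + - 1# * (b ×ᵣ 1#)

    ⟦⟧-difference : ∀ a b → ⟦ a , b ⟧ ≈ a ×ᵣ 1# + - 1# * (b ×ᵣ 1#)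
    ⟦⟧-difference 0             0       = sym (trans (+-identityˡ _) (zeroʳ _))
    ⟦⟧-difference 1             0       = sym (trans (+-congˡ (zeroʳ _)) (trans (+-identityʳ _) (+-identityʳ _)))
    ⟦⟧-difference (ℕ.suc (ℕ.suc a)) 0   = refl
    ⟦⟧-difference 0             (ℕ.suc b) = refl
    ⟦⟧-difference 1             (ℕ.suc b) = refl
    ⟦⟧-difference (ℕ.suc (ℕ.suc a)) (ℕ.suc b) = refl

    differences : RawRing 0ℓ 0ℓ
    differences = record
      { Carrier = ℕ × ℕ ; _≈_ = ≡._≡_
      ; _+_ = λ { (a , b) (c , d) → a ℕ.+ c , b ℕ.+ d }
      ; _*_ = λ { (a , b) (c , d) → a ℕ.* c ℕ.+ b ℕ.* d , a ℕ.* d ℕ.+ b ℕ.* c }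
      ; -_ = λ { (a , b) → b , a }
      ; 0# = 0 , 0 ; 1# = 1 , 0 }

    -- The semiring solver sees -1 as an unknown e, so the relation e + 1 = 0 is inserted by hand: e
    -- e = e e + (e + 1) = e (e + 1) + 1 = 1.
    e*e : - 1# * - 1# ≈ 1#
    e*e = begin
      - 1# * - 1#                      ≈⟨ N.solve 1 (λ e → e N.:* e N.:= e N.:* e N.:+ N.con 0) refl _ ⟩
      - 1# * - 1# + 0#                 ≈⟨ +-congˡ (-‿inverseˡ 1#) ⟨
      - 1# * - 1# + (- 1# + 1#)        ≈⟨ N.solve 1 (λ e → e N.:* e N.:+ (e N.:+ N.con 1)
                                            N.:= e N.:* (e N.:+ N.con 1) N.:+ N.con 1) refl _ ⟩
      - 1# * (- 1# + 1#) + 1#          ≈⟨ +-congʳ (trans (*-congˡ (-‿inverseˡ 1#)) (zeroʳ _)) ⟩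
      0# + 1#                          ≈⟨ +-identityˡ 1# ⟩
      1#                               ∎

    ⟦⟧-* : ∀ a b c d → ⟦ a ℕ.* c ℕ.+ b ℕ.* d , a ℕ.* d ℕ.+ b ℕ.* c ⟧ ≈ ⟦ a , b ⟧ * ⟦ c , d ⟧
    ⟦⟧-* a b c d = begin
      ⟦ a ℕ.* c ℕ.+ b ℕ.* d , a ℕ.* d ℕ.+ b ℕ.* c ⟧
        ≈⟨ ⟦⟧-difference (a ℕ.* c ℕ.+ b ℕ.* d) _ ⟩
      (a ℕ.* c ℕ.+ b ℕ.* d) ×ᵣ 1# + e * ((a ℕ.* d ℕ.+ b ℕ.* c) ×ᵣ 1#)
        ≈⟨ +-cong (+*+ a c b d) (*-congˡ (+*+ a d b c)) ⟩
      (A * C + B * D) + e * (A * D + B * C)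
        -- Once B D is written as e e B D, both sides agree as polynomials with natural
        -- coefficients.
        ≈⟨ +-congʳ (+-congˡ (trans (sym (*-identityˡ _)) (*-congʳ (sym e*e)))) ⟩
      (A * C + e * e * (B * D)) + e * (A * D + B * C)
        ≈⟨ N.solve 5 (λ e A B C D → (A N.:* C N.:+ e N.:* e N.:* (B N.:* D)) N.:+ e N.:* (A N.:* D N.:+ B N.:* C)
             N.:= (A N.:+ e N.:* B) N.:* (C N.:+ e N.:* D)) refl e A B C D ⟩
      (A + e * B) * (C + e * D)
        ≈⟨ *-cong (⟦⟧-difference a b) (⟦⟧-difference c d) ⟨
      ⟦ a , b ⟧ * ⟦ c , d ⟧ ∎
      where
      e = - 1# ; A = a ×ᵣ 1# ; B = b ×ᵣ 1# ; C = c ×ᵣ 1# ; D = d ×ᵣ 1#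
      +*+ : ∀ a c b d → (a ℕ.* c ℕ.+ b ℕ.* d) ×ᵣ 1# ≈ (a ×ᵣ 1#) * (c ×ᵣ 1#) + (b ×ᵣ 1#) * (d ×ᵣ 1#)
      +*+ a c b d = trans (×-homo-+ 1# (a ℕ.* c) (b ℕ.* d)) (+-cong (×1-homo-* a c) (×1-homo-* b d))

    ⟦⟧-homo : differences -Raw-AlmostCommutative⟶ fromCommutativeRing R
    ⟦⟧-homo = record
      { ⟦_⟧ = ⟦_⟧
      ; +-homo = λ { (a , b) (c , d) → trans (⟦⟧-difference (a ℕ.+ c) (b ℕ.+ d))
          (trans (+-cong (×-homo-+ 1# a c) (*-congˡ (×-homo-+ 1# b d)))
          (trans (N.solve 5 (λ e A B C D → (A N.:+ C) N.:+ e N.:* (B N.:+ D)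
            N.:= (A N.:+ e N.:* B) N.:+ (C N.:+ e N.:* D)) refl _ _ _ _ _)
          (sym (+-cong (⟦⟧-difference a b) (⟦⟧-difference c d))))) }
      ; *-homo = λ { (a , b) (c , d) → ⟦⟧-* a b c d }
      ; -‿homo = λ { (a , b) → trans (trans (⟦⟧-difference b a)
          (trans (+-congʳ (trans (sym (*-identityˡ _)) (*-congʳ (sym e*e))))
            (N.solve 3 (λ e A B → e N.:* e N.:* B N.:+ e N.:* A N.:= e N.:* (A N.:+ e N.:* B)) refl _ _ _)))
          (trans (*-congˡ (sym (⟦⟧-difference a b))) (-1*x≈-x _)) }
      ; 0-homo = refl
      ; 1-homo = refl }

    -- Pairs with a + d = c + b denote the same element: adding (e + 1) D = 0 to A + e B and (e + 1)
    -- B = 0 to C + e D makes both sides equal.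
    _coeff≟_ : WeaklyDecidable (Induced-equivalence ⟦⟧-homo)
    (a , b) coeff≟ (c , d) with a ℕ.+ d ℕ.≟ c ℕ.+ b
    ... | no _ = nothing
    ... | yes eq = just (begin
      ⟦ a , b ⟧                           ≈⟨ ⟦⟧-difference a b ⟩
      A + e * B                           ≈⟨ trans (+-cong (+-identityʳ _) (+-identityʳ _)) refl ⟨
      (A + 0#) + (e * B + 0#)             ≈⟨ +-congʳ (+-congˡ e+1*D) ⟨
      (A + (e + 1#) * D) + (e * B + 0#)   ≈⟨ N.solve 4 (λ e A B D → (A N.:+ (e N.:+ N.con 1) N.:* D) N.:+ (e N.:* B N.:+ N.con 0)
                                               N.:= (A N.:+ D) N.:+ (e N.:* B N.:+ e N.:* D)) refl e A B D ⟩
      (A + D) + (e * B + e * D)           ≈⟨ +-congʳ (trans (sym (×-homo-+ 1# a d))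
                                               (trans (reflexive (≡.cong (_×ᵣ 1#) eq)) (×-homo-+ 1# c b))) ⟩
      (C + B) + (e * B + e * D)           ≈⟨ N.solve 4 (λ e C B D → (C N.:+ B) N.:+ (e N.:* B N.:+ e N.:* D)
                                               N.:= (C N.:+ e N.:* D) N.:+ (e N.:+ N.con 1) N.:* B) refl e C B D ⟩
      (C + e * D) + (e + 1#) * B          ≈⟨ +-congˡ (trans (*-congʳ (-‿inverseˡ 1#)) (zeroˡ _)) ⟩
      (C + e * D) + 0#                    ≈⟨ +-identityʳ _ ⟩
      C + e * D                           ≈⟨ ⟦⟧-difference c d ⟨
      ⟦ c , d ⟧                           ∎)
      where
      e = - 1# ; A = a ×ᵣ 1# ; B = b ×ᵣ 1# ; C = c ×ᵣ 1# ; D = d ×ᵣ 1#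
      e+1*D : (e + 1#) * D ≈ 0#
      e+1*D = trans (*-congʳ (-‿inverseˡ 1#)) (zeroˡ _)

  open Algebra.Solver.Ring differences (fromCommutativeRing R) ⟦⟧-homo _coeff≟_ public
    using (Polynomial; solve; _:=_; _:+_; _:*_; :-_; con)

  :0 :1 : ∀ {n} → Polynomial n
  :0 = con (0 , 0)
  :1 = con (1 , 0)

open import Defs
open import Data.Bool using (Bool; true; false; if_then_else_; not; _∧_)
import Data.Bool.Properties as Boolₚ
open import Data.Empty using (⊥; ⊥-elim)
open import Data.Fin as Fin using (Fin; zero; suc; toℕ; fromℕ<; opposite; punchIn)
open import Data.Fin.Permutation as Perm using (Permutation′; _⟨$⟩ʳ_; _⟨$⟩ˡ_; lift₀; insert)
import Data.Fin.Properties as Finₚ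
open import Data.Fin.Subset as Subset using (Subset; _∉_; ∣_∣; ⁅_⁆; _∪_)
import Data.Fin.Subset.Properties as Subsetₚ
import Data.List as List
import Data.List.Membership.Propositional.Properties as Listₚ
import Data.List.Relation.Unary.All as All
open import Data.List.Relation.Unary.AllPairs using (_∷_)
open import Data.List.Relation.Unary.Any using (index)
open import Data.List.Relation.Unary.Any.Properties using (lookup-index)
open import Data.List.Relation.Unary.Unique.Propositional using (Unique)
open import Data.Nat using (zero; suc; _+_; _*_; _^_; _∸_; _≤_; _<_; z≤n; s≤s; _≡ᵇ_)
open import Data.Nat.Divisibility using (divides; ∣m+n∣m⇒∣n; ∣-refl)
open import Data.Nat.Induction using (<-rec)
import Data.Nat.Properties as ℕₚ
open import Data.Nat.Tactic.RingSolver using (solve-∀)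
open import Data.Product using (∃; ∃₂; proj₁; proj₂; uncurry)
open import Data.Product.Relation.Binary.Pointwise.NonDependent using (×-setoid)
open import Data.Sum as Sum using (_⊎_; inj₁; inj₂; [_,_]′)
open import Data.Unit using (⊤; tt)
open import Data.Vec using (Vec; []; _∷_; lookup; tabulate)
import Data.Vec.Properties as Vecₚ
open import Function using (_∘_; id)
open import Function.Bundles using (Inverse; Equivalence)
open import Relation.Binary using (Setoid; tri<; tri≈; tri>)
open import Relation.Binary.PropositionalEquality
  using (_≡_; _≢_; refl; sym; trans; cong; cong₂; subst; module ≡-Reasoning)
open import Relation.Nullary using (Dec; ¬_)
open import Relation.Nullary.Decidable using (map′; ¬?; _×-dec_; _→-dec_)
import Algebra.Properties.CommutativeMonoid.Sum ℕₚ.+-0-commutativeMonoid as ℕSum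
import Algebra.Properties.Semiring.Sum

-- Counting with respect to a setoid equality

-- Vectors and matrices are functions here, so their equality is that of a setoid. `rank` takes the
-- proof of membership, so that in a disjoint union this proof tells the summand.
record Count (S : Setoid 0ℓ 0ℓ) (P : Setoid.Carrier S → Set) (N : ℕ) : Set where
  open Setoid S using (_≈_) renaming (Carrier to A)
  field
    enum     : Fin N → A
    sound    : ∀ i → P (enum i)
    enum-inj : ∀ {i j} → enum i ≈ enum j → i ≡ j
    rank     : ∀ {a} → P a → Fin N
    complete : ∀ {a} (p : P a) → enum (rank p) ≈ a

open Count

private variable
  m n N : ℕ

module _ (S : Setoid 0ℓ 0ℓ) where
  open Setoid S using (_≈_) renaming (Carrier to A; sym to ≈-sym; trans to ≈-trans; refl to ≈-refl)

  Count-resp : ∀ {P Q : A → Set} → (∀ {a} → P a → Q a) → (∀ {a} → Q a → P a) →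
               Count S P N → Count S Q N
  Count-resp f g c = record
    { enum = enum c ; sound = λ i → f (sound c i) ; enum-inj = enum-inj c
    ; rank = λ q → rank c (g q) ; complete = λ q → complete c (g q) }

  Count-≤ : ∀ {P Q : A → Set} → (∀ {a} → P a → Q a) → Count S P m → Count S Q n → m ≤ n
  Count-≤ f c d = Finₚ.injective⇒≤ {f = λ i → rank d (f (sound c i))} λ {i} {j} eq →
    enum-inj c (≈-trans (≈-sym (complete d (f (sound c i))))
      (≈-trans (Setoid.reflexive S (cong (enum d) eq)) (complete d (f (sound c j)))))

  Count-unique : ∀ {P Q : A → Set} → (∀ {a} → P a → Q a) → (∀ {a} → Q a → P a) →
                 Count S P m → Count S Q n → m ≡ n
  Count-unique f g c d = ℕₚ.≤-antisym (Count-≤ f c d) (Count-≤ g d c)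

  Count-empty : ∀ {P : A → Set} → (∀ {a} → ¬ P a) → Count S P 0
  Count-empty ¬P = record
    { enum = λ () ; sound = λ () ; enum-inj = λ { {()} }
    ; rank = λ p → ⊥-elim (¬P p) ; complete = λ p → ⊥-elim (¬P p) }

  Count-single : ∀ {P : A → Set} (a : A) → P a → (∀ {b} → P b → a ≈ b) → Count S P 1
  Count-single a pa uniq = record
    { enum = λ _ → a ; sound = λ _ → pa ; enum-inj = λ { {zero} {zero} _ → refl }
    ; rank = λ _ → zero ; complete = uniq }

  Count-⊎ : ∀ {P Q : A → Set} → (∀ {a b} → a ≈ b → P a → Q b → ⊥) →
            Count S P m → Count S Q n → Count S (λ a → P a ⊎ Q a) (m + n)
  Count-⊎ {m = m} {n = n} {P} {Q} disj c d = record
    { enum = λ i → en (Fin.splitAt m i)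
    ; sound = λ i → so (Fin.splitAt m i)
    ; enum-inj = λ {i} {j} eq → trans (sym (Finₚ.join-splitAt m n i))
        (trans (cong (Fin.join m n) (inj (Fin.splitAt m i) (Fin.splitAt m j) eq))
               (Finₚ.join-splitAt m n j))
    ; rank = λ p → Fin.join m n (ra p)
    ; complete = λ {a} p →
        subst (λ z → en z ≈ a) (sym (Finₚ.splitAt-join m n (ra p))) (co p) }
    where
    en : Fin m ⊎ Fin n → A
    en = [ enum c , enum d ]′
    so : ∀ z → P (en z) ⊎ Q (en z)
    so (inj₁ i) = inj₁ (sound c i)
    so (inj₂ i) = inj₂ (sound d i)
    inj : ∀ y z → en y ≈ en z → y ≡ z
    inj (inj₁ i) (inj₁ j) eq = cong inj₁ (enum-inj c eq)
    inj (inj₂ i) (inj₂ j) eq = cong inj₂ (enum-inj d eq)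
    inj (inj₁ i) (inj₂ j) eq = ⊥-elim (disj eq (sound c i) (sound d j))
    inj (inj₂ i) (inj₁ j) eq = ⊥-elim (disj (≈-sym eq) (sound c j) (sound d i))
    ra : ∀ {a} → P a ⊎ Q a → Fin m ⊎ Fin n
    ra (inj₁ p) = inj₁ (rank c p)
    ra (inj₂ q) = inj₂ (rank d q)
    co : ∀ {a} (p : P a ⊎ Q a) → en (ra p) ≈ a
    co (inj₁ p) = complete c p
    co (inj₂ q) = complete d q

  Count-∃ : ∀ {m} {Q : Fin m → A → Set} (w : Fin m → ℕ) → (∀ j → Count S (Q j) (w j)) →
            (∀ {i j a b} → a ≈ b → Q i a → Q j b → i ≡ j) →
            Count S (λ a → ∃ λ j → Q j a) (sumℕ w)
  Count-∃ {zero}  w c disj = Count-empty λ { (() , _) }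
  Count-∃ {suc m} w c disj = Count-resp
    (λ { (inj₁ p) → zero , p ; (inj₂ (j , p)) → suc j , p })
    (λ { (zero , p) → inj₁ p ; (suc j , p) → inj₂ (j , p) })
    (Count-⊎ (λ eq p (j , q) → Finₚ.0≢1+n (disj eq p q)) (c zero)
      (Count-∃ (w ∘ suc) (c ∘ suc) λ eq p q → Finₚ.suc-injective (disj eq p q)))

  -- Each member of the enumeration satisfies R or not, so the new count is a sum of ones and zeros;
  -- its value is left unspecified.
  Count-filter : ∀ {P R : A → Set} → Count S P N → (∀ {a b} → a ≈ b → R a → R b) →
                 (∀ a → Dec (R a)) → ∃ λ N′ → Count S (λ a → P a × R a) N′
  Count-filter {N = N} {P} {R} c R-resp R? = _ ,
    Count-resp (λ {a} (i , p , r , eq) → p , r)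
      (λ {a} (p , r) → rank c p , p , r , complete c p)
      (Count-∃ {Q = λ i a → P a × R a × enum c i ≈ a} (λ i → proj₁ (one i)) (λ i → proj₂ (one i))
        λ eq (_ , _ , e₁) (_ , _ , e₂) → enum-inj c (≈-trans e₁ (≈-trans eq (≈-sym e₂))))
    where
    one : ∀ i → ∃ (Count S (λ a → P a × R a × enum c i ≈ a))
    one i with R? (enum c i)
    ... | no ¬r = 0 , Count-empty λ (_ , r , eq) → ¬r (R-resp (≈-sym eq) r)
    ... | yes r = 1 , record
      { enum = λ _ → enum c i ; sound = λ _ → sound c i , r , ≈-refl
      ; enum-inj = λ { {zero} {zero} _ → refl }
      ; rank = λ _ → zero ; complete = λ (_ , _ , eq) → eq }

  Count-search : ∀ {P R : A → Set} → Count S P N → (∀ {a b} → a ≈ b → R a → R b) →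
                 (∀ a → Dec (R a)) → Dec (∃ λ a → P a × R a)
  Count-search c R-resp R? with Finₚ.any? (λ i → R? (enum c i))
  ... | yes (i , r) = yes (enum c i , sound c i , r)
  ... | no ¬r = no λ (a , p , r) → ¬r (rank c p , R-resp (≈-sym (complete c p)) r)

record Bijection (S T : Setoid 0ℓ 0ℓ) (P : Setoid.Carrier S → Set) (Q : Setoid.Carrier T → Set) : Set where
  private
    module S = Setoid S
    module T = Setoid T
  field
    to        : S.Carrier → T.Carrier
    from      : T.Carrier → S.Carrier
    to-cong   : ∀ {a b} → a S.≈ b → to a T.≈ to b
    from-cong : ∀ {a b} → a T.≈ b → from a S.≈ from b
    to-mem    : ∀ {a} → P a → Q (to a)
    from-mem  : ∀ {b} → Q b → P (from b)
    from∘to   : ∀ {a} → P a → from (to a) S.≈ a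
    to∘from   : ∀ {b} → Q b → to (from b) T.≈ b

module _ {S T : Setoid 0ℓ 0ℓ} {P : Setoid.Carrier S → Set} {Q : Setoid.Carrier T → Set} where
  private
    module S = Setoid S
    module T = Setoid T

  reverse : Bijection S T P Q → Bijection T S Q P
  reverse β = record
    { to = from ; from = to ; to-cong = from-cong ; from-cong = to-cong
    ; to-mem = from-mem ; from-mem = to-mem ; from∘to = to∘from ; to∘from = from∘to }
    where open Bijection β

  Count-map : Bijection S T P Q → Count S P N → Count T Q N
  Count-map β c = record
    { enum = to ∘ enum c
    ; sound = λ i → to-mem (sound c i)
    ; enum-inj = λ {i} {j} eq → enum-inj c
        (S.trans (S.sym (from∘to (sound c i))) (S.trans (from-cong eq) (from∘to (sound c j))))
    ; rank = λ q → rank c (from-mem q)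
    ; complete = λ q → T.trans (to-cong (complete c (from-mem q))) (to∘from q) }
    where open Bijection β

module _ (S T : Setoid 0ℓ 0ℓ) where
  private
    module S = Setoid S
    module T = Setoid T

  Count-× : {P : S.Carrier → Set} {Q : T.Carrier → Set} → Count S P m → Count T Q n →
            Count (×-setoid S T) (λ (a , b) → P a × Q b) (m * n)
  Count-× {m = m} {n = n} {P} {Q} c d = record
    { enum = λ i → en (Fin.remQuot n i)
    ; sound = λ i → sound c _ , sound d _
    ; enum-inj = λ {i} {j} (e₁ , e₂) → trans (sym (Finₚ.combine-remQuot {m} n i))
        (trans (cong₂ Fin.combine (enum-inj c e₁) (enum-inj d e₂)) (Finₚ.combine-remQuot {m} n j))
    ; rank = λ (p , q) → Fin.combine (rank c p) (rank d q)
    ; complete = λ {a} (p , q) →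
        subst (λ z → Setoid._≈_ (×-setoid S T) (en z) a)
          (sym (Finₚ.remQuot-combine (rank c p) (rank d q))) (complete c p , complete d q) }
    where
    en : Fin m × Fin n → S.Carrier × T.Carrier
    en (i , j) = enum c i , enum d j

  -- The fibres of `φ` are taken over the representatives `enum c j`, and `enum-inj` makes them
  -- disjoint. This serves to sort matrices by their column 0.
  Count-fibre : {P : S.Carrier → Set} {B : T.Carrier → Set} (φ : S.Carrier → T.Carrier) →
    (∀ {a b} → a S.≈ b → φ a T.≈ φ b) → (c : Count T B m) (w : Fin m → ℕ) →
    (∀ j → Count S (λ a → P a × φ a T.≈ enum c j) (w j)) → (∀ {a} → P a → B (φ a)) →
    Count S P (sumℕ w)
  Count-fibre φ φ-cong c w fib PB = Count-resp S
    (λ (_ , p , _) → p)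
    (λ p → rank c (PB p) , p , T.sym (complete c (PB p)))
    (Count-∃ S w fib λ eq (_ , e₁) (_ , e₂) →
      enum-inj c (T.trans (T.sym e₁) (T.trans (φ-cong eq) e₂)))

sumℕ-const : ∀ m w → sumℕ {m} (λ _ → w) ≡ m * w
sumℕ-const zero    w = refl
sumℕ-const (suc m) w = cong (w +_) (sumℕ-const m w)

sumℕ-*ˡ : ∀ {m} c (w : Fin m → ℕ) → sumℕ (λ j → c * w j) ≡ c * sumℕ w
sumℕ-*ˡ {zero}  c w = sym (ℕₚ.*-zeroʳ c)
sumℕ-*ˡ {suc m} c w = trans (cong (c * w zero +_) (sumℕ-*ˡ c (w ∘ suc))) (sym (ℕₚ.*-distribˡ-+ c _ _))

Unique-lookup-injective : ∀ {A : Set} {xs : List.List A} → Unique xs → ∀ i j →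
  List.lookup xs i ≡ List.lookup xs j → i ≡ j
Unique-lookup-injective (_ ∷ _)  zero    zero    _  = refl
Unique-lookup-injective {xs = _ List.∷ xs} (x∉ ∷ _) zero    (suc j) eq =
  ⊥-elim (All.lookup x∉ (Listₚ.∈-lookup {xs = xs} j) eq)
Unique-lookup-injective {xs = _ List.∷ xs} (x∉ ∷ _) (suc i) zero    eq =
  ⊥-elim (All.lookup x∉ (Listₚ.∈-lookup {xs = xs} i) (sym eq))
Unique-lookup-injective (_ ∷ u)  (suc i) (suc j) eq = cong suc (Unique-lookup-injective u i j eq)

HasCount⇒Count : ∀ {A : Set} {P : A → Set} → HasCount P N → Count (≡.setoid A) P N
HasCount⇒Count (xs , uniq , mem , refl) = record
  { enum = List.lookup xs
  ; sound = λ i → proj₁ (mem _) (Listₚ.∈-lookup {xs = xs} i)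
  ; enum-inj = λ {i} {j} → Unique-lookup-injective uniq i j
  ; rank = λ {a} p → index (proj₂ (mem a) p)
  ; complete = λ {a} p → sym (lookup-index (proj₂ (mem a) p)) }

-- Diagrams with reversed indices

record Shape (F : Diagram n) : Set where
  field
    symm : ∀ i j → F i j ≡ F j i
    up   : ∀ {i j s t} → F i j ≡ true → toℕ i ≤ toℕ s → toℕ j ≤ toℕ t → F s t ≡ true
open Shape

-- As indices run backwards, n ≤ a + i says that row i is among the first a rows of the original
-- numbering. Matrices supported in F then have rank at most a + b.
Covered : ℕ → ℕ → Diagram n → Set
Covered {n} a b F = ∀ i j → F i j ≡ true → n ≤ a + toℕ i ⊎ n ≤ b + toℕ j

delete₀ : Diagram (suc n) → Diagram n
delete₀ F i j = F (suc i) (suc j)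

delete : Fin (suc n) → Diagram (suc n) → Diagram n
delete p F i j = F (punchIn p i) (punchIn p j)

Shape-delete₀ : {F : Diagram (suc n)} → Shape F → Shape (delete₀ F)
Shape-delete₀ S = record
  { symm = λ i j → symm S (suc i) (suc j) ; up = λ f i≤s j≤t → up S f (s≤s i≤s) (s≤s j≤t) }

Shape-delete : ∀ p {F : Diagram (suc n)} → Shape F → Shape (delete p F)
Shape-delete p S = record
  { symm = λ i j → symm S (punchIn p i) (punchIn p j)
  ; up = λ {i} {j} {s} {t} f i≤s j≤t → up S f (Finₚ.punchIn-mono-≤ p i s i≤s) (Finₚ.punchIn-mono-≤ p j t j≤t) }

countᵇ-punchIn : ∀ (f : Fin (suc n) → Bool) p →
  countᵇ f ≡ (if f p then 1 else 0) + countᵇ (f ∘ punchIn p)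
countᵇ-punchIn f zero = refl
countᵇ-punchIn {suc n} f (suc p) = trans
  (cong ((if f zero then 1 else 0) +_) (countᵇ-punchIn (f ∘ suc) p))
  (x+[y+z]≡y+[x+z] (if f zero then 1 else 0) (if f (suc p) then 1 else 0) _)
  where
  x+[y+z]≡y+[x+z] : ∀ x y z → x + (y + z) ≡ y + (x + z)
  x+[y+z]≡y+[x+z] = solve-∀

countᵇ-all : {f : Fin n → Bool} → (∀ i → f i ≡ true) → countᵇ f ≡ n
countᵇ-all {zero}  all = refl
countᵇ-all {suc n} all rewrite all zero = cong suc (countᵇ-all (all ∘ suc))

punchIn-cases : ∀ (p : Fin (suc n)) x → toℕ (punchIn p x) ≡ toℕ x ⊎ toℕ p ≤ toℕ x
punchIn-cases zero    x       = inj₂ z≤n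
punchIn-cases (suc p) zero    = inj₁ refl
punchIn-cases (suc p) (suc x) = Sum.map (cong suc) s≤s (punchIn-cases p x)

Covered-delete₀ : ∀ {a b} {F : Diagram (suc n)} → Covered a b F → Covered a b (delete₀ F)
Covered-delete₀ {n} C i j f = Sum.map strip strip (C (suc i) (suc j) f)
  where
  strip : ∀ {a x} → suc n ≤ a + suc x → n ≤ a + x
  strip {a} {x} le = ℕₚ.≤-pred (subst (suc n ≤_) (ℕₚ.+-suc a x) le)

-- If neither a nor b is the whole size, the two given cells place the index `suc p` both in the
-- covered rows and in the covered columns, and its deletion lowers a and b by one each. If one of
-- them is the whole size, the other and c are 0, and (m, 0) or (0, m) covers everything.
Covered-delete : ∀ {m a b c} {F : Diagram (2 + m)} (p : Fin (suc m)) → Covered a b F → a + b + c ≡ 2 + m →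
  F zero (suc p) ≡ true → F (suc p) zero ≡ true →
  ∃₂ λ a′ b′ → Covered a′ b′ (delete p (delete₀ F)) × a′ + b′ + c ≡ m × 2 + (a′ + b′) ≡ a + b
Covered-delete {m} {a} {b} {c} p C eq f g with C zero (suc p) f | C (suc p) zero g
... | inj₁ le | _ = m , 0 , (λ i j _ → inj₁ (ℕₚ.m≤m+n m (toℕ i))) , a≡2+m le eq
  where
  a≡2+m : 2 + m ≤ a + 0 → a + b + c ≡ 2 + m → m + 0 + c ≡ m × 2 + (m + 0) ≡ a + b
  a≡2+m le eq = trans (cong (m + 0 +_) c≡0) (trans (ℕₚ.+-identityʳ _) (ℕₚ.+-identityʳ m))
    , trans (cong (2 +_) (ℕₚ.+-identityʳ m)) (sym a+b≡2+m)
    where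
    a+b≡2+m : a + b ≡ 2 + m
    a+b≡2+m = ℕₚ.≤-antisym (ℕₚ.≤-trans (ℕₚ.m≤m+n _ c) (ℕₚ.≤-reflexive eq))
      (ℕₚ.≤-trans le (ℕₚ.+-monoʳ-≤ a z≤n))
    c≡0 : c ≡ 0
    c≡0 = ℕₚ.+-cancelˡ-≡ (a + b) c 0 (trans eq (sym (trans (ℕₚ.+-identityʳ _) a+b≡2+m)))
... | inj₂ _ | inj₂ le = 0 , m , (λ i j _ → inj₂ (ℕₚ.m≤m+n m (toℕ j))) , b≡2+m
  where
  a+b≡2+m : a + b ≡ 2 + m
  a+b≡2+m = ℕₚ.≤-antisym (ℕₚ.≤-trans (ℕₚ.m≤m+n _ c) (ℕₚ.≤-reflexive eq))
    (ℕₚ.≤-trans le (ℕₚ.≤-trans (ℕₚ.≤-reflexive (ℕₚ.+-identityʳ b)) (ℕₚ.m≤n+m b a)))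
  b≡2+m : m + c ≡ m × 2 + m ≡ a + b
  b≡2+m = trans (cong (m +_) (ℕₚ.+-cancelˡ-≡ (a + b) c 0 (trans eq (sym (trans (ℕₚ.+-identityʳ _) a+b≡2+m)))))
    (ℕₚ.+-identityʳ m) , sym a+b≡2+m
-- With a = 0 the bound would make `suc p` at least the size 2 + m; the same happens for b = 0.
Covered-delete {m} {zero} p C eq f g | inj₂ _ | inj₁ le =
  ⊥-elim (ℕₚ.<⇒≱ (Finₚ.toℕ<n p) (ℕₚ.≤-pred le))
Covered-delete {m} {suc a} {zero} p C eq f g | inj₂ le | inj₁ _ =
  ⊥-elim (ℕₚ.<⇒≱ (Finₚ.toℕ<n p) (ℕₚ.≤-pred le))
Covered-delete {m} {suc a} {suc b} {c} {F} p C eq f g | inj₂ le₁ | inj₁ le₂ =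
  a , b , (λ i j h → Sum.map (below i (strip a _ le₂)) (below j (strip b _ le₁)) (C _ _ h))
  , ℕₚ.suc-injective (ℕₚ.suc-injective (trans (shift a b c) eq)) , cong suc (sym (ℕₚ.+-suc a b))
  where
  shift : ∀ a b c → 2 + (a + b + c) ≡ suc a + suc b + c
  shift = solve-∀
  strip : ∀ a x → 2 + m ≤ suc a + suc x → m ≤ a + x
  strip a x le = ℕₚ.≤-pred (subst (suc m ≤_) (ℕₚ.+-suc a x) (ℕₚ.≤-pred le))
  below : ∀ {a} i → m ≤ a + toℕ p → 2 + m ≤ suc a + suc (toℕ (punchIn p i)) → m ≤ a + toℕ i
  -- Either `punchIn p` does not move i, and the bound of its image serves, or p ≤ i, and the bound
  -- of p does.
  below {a} i m≤a+p le with punchIn-cases p i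
  ... | inj₁ e   = subst (λ z → m ≤ a + z) e (strip a _ le)
  ... | inj₂ p≤i = ℕₚ.≤-trans m≤a+p (ℕₚ.+-monoʳ-≤ a p≤i)

Even-2+ : ∀ {x y} → 2 + x ≡ y → Even y → Even x
Even-2+ refl e = ∣m+n∣m⇒∣n e ∣-refl

countᵇ-permute : (f : Fin n → Bool) (π : Permutation′ n) → countᵇ (f ∘ (π ⟨$⟩ʳ_)) ≡ countᵇ f
countᵇ-permute f π = trans (countᵇ≡sum (f ∘ (π ⟨$⟩ʳ_)))
  (sym (trans (countᵇ≡sum f) (ℕSum.sum-permute (λ i → if f i then 1 else 0) π)))
  where
  countᵇ≡sum : ∀ {n} (f : Fin n → Bool) → countᵇ f ≡ ℕSum.sum (λ i → if f i then 1 else 0)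
  countᵇ≡sum {zero}  f = refl
  countᵇ≡sum {suc n} f = cong ((if f zero then 1 else 0) +_) (countᵇ≡sum (f ∘ suc))

-- A covering from the diagonal sequence

1≤countᵇ : (f : Fin n → Bool) (j : Fin n) → f j ≡ true → 1 ≤ countᵇ f
1≤countᵇ f zero    e rewrite e = s≤s z≤n
1≤countᵇ f (suc j) e = ℕₚ.≤-trans (1≤countᵇ (f ∘ suc) j e) (ℕₚ.m≤n+m _ (if f zero then 1 else 0))

sumℕ-≥ : (f : Fin n → ℕ) (s : ℕ) → s ≤ n → (∀ i → toℕ i < s → 1 ≤ f i) → s ≤ sumℕ f
sumℕ-≥         f zero    _         _   = z≤n
sumℕ-≥ {suc n} f (suc s) (s≤s s≤n) pos =
  ℕₚ.+-mono-≤ (pos zero (s≤s z≤n)) (sumℕ-≥ (f ∘ suc) s s≤n (λ i i<s → pos (suc i) (s≤s i<s)))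

lookup≤∂ : ∀ {ℓ} (d : Vec ℕ ℓ) k → lookup d k ≤ ∂ d
lookup≤∂ (x ∷ d) zero    = ℕₚ.m≤m⊔n x (∂ d)
lookup≤∂ (x ∷ d) (suc k) = ℕₚ.≤-trans (lookup≤∂ d k) (ℕₚ.m≤n⊔m x (∂ d))

Cell : Diagram n → ℕ → ℕ → Set
Cell F a b = ∃₂ λ i j → toℕ i ≡ a × toℕ j ≡ b × F i j ≡ true

Cell? : (F : Diagram n) → ∀ a b → Dec (Cell F a b)
Cell? F a b = Finₚ.any? λ i → Finₚ.any? λ j → (toℕ i ℕ.≟ a) ×-dec ((toℕ j ℕ.≟ b) ×-dec (F i j Boolₚ.≟ true))

-- Each of the rows 0, ..., r contributes at least one cell to the sum.
diagSize-full : (F : Diagram n) (r : ℕ) → (∀ a → a ≤ r → Cell F a (r ∸ a)) → r < diagSize F r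
diagSize-full {n} F r cell = sumℕ-≥ _ (suc r)
  -- The cell (r, 0) shows that there are more than r rows.
  (let i , _ , i≡r , _ = cell r ℕₚ.≤-refl in subst (_< n) i≡r (Finₚ.toℕ<n i)) row
  where
  row : ∀ i → toℕ i < suc r → 1 ≤ countᵇ (λ j → F i j ∧ (toℕ i + toℕ j ≡ᵇ r))
  row i (s≤s i≤r) with i′ , j , i′≡i , j≡ , f ← cell (toℕ i) i≤r with Finₚ.toℕ-injective i′≡i
  ... | refl = 1≤countᵇ _ j (cong₂ _∧_ f (Equivalence.to Boolₚ.T-≡
    (ℕₚ.≡⇒≡ᵇ _ r (trans (cong (toℕ i +_) j≡) (ℕₚ.m+[n∸m]≡n i≤r)))))

-- If the whole diagonal i + j = ∂ d were in F, it would have ∂ d + 1 cells; a missing cell (a , b) of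
-- this diagonal confines F to the first a rows and the first b columns.
cover : ∀ {ℓ} (d : Vec ℕ ℓ) (F : Diagram n) → IsFerrers F → HasDiagonalSequence F d →
        ∃₂ λ a b → a + b ≡ ∂ d × (∀ i j → F i j ≡ true → toℕ i < a ⊎ toℕ j < b)
cover {n} {ℓ} d F ferrers (sizes , bound) with Finₚ.any? {n = suc (∂ d)} (λ a → ¬? (Cell? F (toℕ a) (∂ d ∸ toℕ a)))
... | yes (x , ¬cell) = a , ∂ d ∸ a , ℕₚ.m+[n∸m]≡n (ℕₚ.≤-pred (Finₚ.toℕ<n x)) , covered
  where
  a = toℕ x
  covered : ∀ i j → F i j ≡ true → toℕ i < a ⊎ toℕ j < ∂ d ∸ a
  covered i j f with toℕ i ℕ.<? a | toℕ j ℕ.<? ∂ d ∸ a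
  ... | yes lt | _      = inj₁ lt
  ... | no _   | yes lt = inj₂ lt
  -- Here (i, j) dominates the missing cell, which F would then contain as well.
  ... | no i≮a | no j≮b = ⊥-elim (¬cell (fromℕ< a<n , fromℕ< b<n , Finₚ.toℕ-fromℕ< a<n , Finₚ.toℕ-fromℕ< b<n ,
    ferrers i j _ _ f (subst (_≤ toℕ i) (sym (Finₚ.toℕ-fromℕ< a<n)) (ℕₚ.≮⇒≥ i≮a))
                      (subst (_≤ toℕ j) (sym (Finₚ.toℕ-fromℕ< b<n)) (ℕₚ.≮⇒≥ j≮b))))
    where
    a<n : a < n
    a<n = ℕₚ.≤-<-trans (ℕₚ.≮⇒≥ i≮a) (Finₚ.toℕ<n i)
    b<n : ∂ d ∸ a < n
    b<n = ℕₚ.≤-<-trans (ℕₚ.≮⇒≥ j≮b) (Finₚ.toℕ<n j)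
... | no ¬∃ = ⊥-elim (ℕₚ.<⇒≱ (diagSize-full F (∂ d) cell)
  (subst (_≤ ∂ d) (trans (sym (sizes k)) (cong (diagSize F) (Finₚ.toℕ-fromℕ< ∂<ℓ))) (lookup≤∂ d k)))
  where
  cell : ∀ a → a ≤ ∂ d → Cell F a (∂ d ∸ a)
  cell a a≤∂ with Cell? F a (∂ d ∸ a)
  ... | yes c = c
  ... | no ¬c = ⊥-elim (¬∃ (fromℕ< (s≤s a≤∂) ,
    subst (λ z → ¬ Cell F z (∂ d ∸ z)) (sym (Finₚ.toℕ-fromℕ< (s≤s a≤∂))) ¬c))
  -- The cell (0, ∂ d) puts this diagonal within the first ℓ ones, so its size is an entry of d and
  -- at most ∂ d.
  ∂<ℓ : ∂ d < ℓ
  ∂<ℓ = let i , j , i≡0 , j≡∂ , f = cell 0 z≤n in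
    subst (_< ℓ) (cong₂ _+_ i≡0 j≡∂) (bound i j f)
  k = fromℕ< ∂<ℓ

-- Reversing the indices of a diagram

rotate : Diagram n → Diagram n
rotate F i j = F (opposite i) (opposite j)

opposite-anti : ∀ {i j : Fin n} → toℕ i ≤ toℕ j → toℕ (opposite j) ≤ toℕ (opposite i)
opposite-anti {n} {i} {j} i≤j rewrite Finₚ.opposite-prop i | Finₚ.opposite-prop j = ℕₚ.∸-monoʳ-≤ n (s≤s i≤j)

rotate-shape : {F : Diagram n} → IsFerrers F → IsSymmetricDiagram F → Shape (rotate F)
rotate-shape {F = F} ferrers symmetric = record
  { symm = λ i j → F-sym (opposite i) (opposite j)
  ; up = λ f i≤s j≤t → ferrers _ _ _ _ f (opposite-anti i≤s) (opposite-anti j≤t) }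
  where
  F-sym : ∀ i j → F i j ≡ F j i
  F-sym i j with F i j in e₁ | F j i in e₂
  ... | true  | true  = refl
  ... | false | false = refl
  ... | true  | false = trans (sym (symmetric i j e₁)) e₂
  ... | false | true  = trans (sym e₁) (symmetric j i e₂)

rotate-covered : ∀ {a b} {F : Diagram n} → (∀ i j → F i j ≡ true → toℕ i < a ⊎ toℕ j < b) → Covered a b (rotate F)
rotate-covered {n} C i j f = Sum.map (flipped i) (flipped j) (C (opposite i) (opposite j) f)
  where
  flipped : ∀ {a} i → toℕ (opposite {n} i) < a → n ≤ a + toℕ i
  flipped {a} i lt = ℕₚ.≤-trans (ℕₚ.m≤n+m∸n n (suc (toℕ i)))
    (ℕₚ.≤-trans (ℕₚ.≤-reflexive (trans (cong suc (ℕₚ.+-comm (toℕ i) _)) (cong (λ z → suc z + toℕ i) (sym (Finₚ.opposite-prop i)))))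
      (ℕₚ.+-monoˡ-≤ (toℕ i) lt))

module OverField {q : ℕ} (K : FiniteField q) where
  open FiniteField K renaming (Carrier to k; _+_ to infixl 6 _⊕_; _*_ to infixl 7 _⊗_; -_ to infix 8 ⊖_)
  open Matrices K using (Σ'; LinIndepCols; HasRank; Mat; _[_,_]; SupportIn; AltRankIn; SymRankIn)

  ring : CommutativeRing 0ℓ 0ℓ
  ring = record { isCommutativeRing = isCommutativeRing }

  open CommutativeRing ring using (semiring; +-identityˡ; +-identityʳ; zeroˡ; zeroʳ; *-identityˡ; *-identityʳ; -‿inverseʳ; *-assoc)
  open Algebra.Properties.Ring (CommutativeRing.ring ring) using (-1*x≈-x)
  open CommutativeRingSolver ring

  -- Finite sums in the field

  module FieldSum = Algebra.Properties.Semiring.Sum semiring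

  Σ≡sum : (f : Fin n → k) → Σ' f ≡ FieldSum.sum f
  Σ≡sum {zero}  f = refl
  Σ≡sum {suc n} f = cong (f zero ⊕_) (Σ≡sum (f ∘ suc))

  Σ-cong : {f g : Fin n → k} → (∀ i → f i ≡ g i) → Σ' f ≡ Σ' g
  Σ-cong {zero}  eq = refl
  Σ-cong {suc n} eq = cong₂ _⊕_ (eq zero) (Σ-cong (eq ∘ suc))

  Σ-0 : {f : Fin n → k} → (∀ i → f i ≡ 0#) → Σ' f ≡ 0#
  Σ-0 {zero}  eq = refl
  Σ-0 {suc n} eq = trans (cong₂ _⊕_ (eq zero) (Σ-0 (eq ∘ suc))) (+-identityˡ 0#)

  Σ-+ : (f g : Fin n → k) → Σ' (λ i → f i ⊕ g i) ≡ Σ' f ⊕ Σ' g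
  Σ-+ f g = trans (Σ≡sum (λ i → f i ⊕ g i)) (trans (FieldSum.∑-distrib-+ f g) (sym (cong₂ _⊕_ (Σ≡sum f) (Σ≡sum g))))

  Σ-*ˡ : ∀ x (f : Fin n → k) → Σ' (λ i → x ⊗ f i) ≡ x ⊗ Σ' f
  Σ-*ˡ x f = trans (Σ≡sum (λ i → x ⊗ f i)) (sym (trans (cong (x ⊗_) (Σ≡sum f)) (FieldSum.*-distribˡ-sum x f)))

  Σ-permute : (f : Fin n → k) (π : Permutation′ n) → Σ' (f ∘ (π ⟨$⟩ʳ_)) ≡ Σ' f
  Σ-permute f π = trans (Σ≡sum (f ∘ (π ⟨$⟩ʳ_))) (sym (trans (Σ≡sum f) (FieldSum.sum-permute f π)))

  Σ-comm : (f : Fin m → Fin n → k) → Σ' (λ i → Σ' (f i)) ≡ Σ' (λ j → Σ' (λ i → f i j))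
  Σ-comm f = trans (ΣΣ f) (trans (FieldSum.∑-comm f) (sym (ΣΣ λ j i → f i j)))
    where
    ΣΣ : ∀ {m n} (g : Fin m → Fin n → k) → Σ' (λ i → Σ' (g i)) ≡ FieldSum.sum (λ i → FieldSum.sum (g i))
    ΣΣ g = trans (Σ-cong λ i → Σ≡sum (g i)) (Σ≡sum λ i → FieldSum.sum (g i))

  -- Counting scalars and vectors

  open Inverse finite using () renaming (to to toFin; from to fromFin)

  fromFin-toFin : ∀ x → fromFin (toFin x) ≡ x
  fromFin-toFin x = Inverse.strictlyInverseʳ finite x

  toFin-fromFin : ∀ i → toFin (fromFin i) ≡ i
  toFin-fromFin i = Inverse.strictlyInverseˡ finite i

  infix 4 _≟_
  _≟_ : (x y : k) → Dec (x ≡ y)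
  x ≟ y = map′ (λ eq → trans (sym (fromFin-toFin x)) (trans (cong fromFin eq) (fromFin-toFin y)))
               (cong toFin) (toFin x Fin.≟ toFin y)

  scalars : Setoid 0ℓ 0ℓ
  scalars = ≡.setoid k

  vectors : ℕ → Setoid 0ℓ 0ℓ
  vectors n = record { Carrier = Fin n → k ; _≈_ = λ x y → ∀ i → x i ≡ y i
    ; isEquivalence = record { refl = λ _ → refl ; sym = λ e i → sym (e i) ; trans = λ e f i → trans (e i) (f i) } }

  Matrix : ℕ → Set
  Matrix n = Fin n → Fin n → k

  matrices : ℕ → Setoid 0ℓ 0ℓ
  matrices n = record { Carrier = Matrix n ; _≈_ = λ x y → ∀ i j → x i j ≡ y i j
    ; isEquivalence = record { refl = λ _ _ → refl ; sym = λ e i j → sym (e i j)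
                             ; trans = λ e f i j → trans (e i j) (f i j) } }

  count-scalars : Count scalars (λ _ → ⊤) q
  count-scalars = record
    { enum = fromFin ; sound = λ _ → tt
    ; enum-inj = λ {i} {j} eq → trans (sym (toFin-fromFin i)) (trans (cong toFin eq) (toFin-fromFin j))
    ; rank = λ {x} _ → toFin x ; complete = λ {x} _ → fromFin-toFin x }

  count-zero : Count scalars (_≡ 0#) 1
  count-zero = Count-single scalars 0# refl sym

  -- The count of the units provides q - 1 without a subtraction.
  count-units∃ : ∃ λ q⁻ → Count scalars (_≢ 0#) q⁻
  count-units∃ with Count-filter scalars count-scalars (λ eq x≢0 → subst (_≢ 0#) eq x≢0) (λ x → ¬? (x ≟ 0#))
  ... | q⁻ , c = q⁻ , Count-resp scalars proj₂ (tt ,_) c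

  q⁻ : ℕ
  q⁻ = proj₁ count-units∃

  count-units : Count scalars (_≢ 0#) q⁻
  count-units = proj₂ count-units∃

  suc-q⁻ : suc q⁻ ≡ q
  suc-q⁻ = Count-unique scalars (λ _ → tt) (λ {x} _ → dec x)
    (Count-⊎ scalars (λ eq p np → np (trans (sym eq) p)) count-zero count-units) count-scalars
    where
    dec : ∀ x → x ≡ 0# ⊎ x ≢ 0#
    dec x with x ≟ 0#
    ... | yes e = inj₁ e
    ... | no ne = inj₂ ne

  1<q : 1 < q
  1<q = subst (1 <_) suc-q⁻ (s≤s (ℕₚ.≤-trans (Count-≤ scalars (λ { refl → 0≢1 ∘ sym })
    (Count-single scalars {P = _≡ 1#} 1# refl sym) count-units) ℕₚ.≤-refl))

  q^-injective : ∀ {i j} → q ^ i ≡ q ^ j → i ≡ j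
  q^-injective {i} {j} eq with ℕₚ.<-cmp i j
  ... | tri< i<j _ _ = ⊥-elim (ℕₚ.<⇒≢ (ℕₚ.^-monoʳ-< q 1<q i<j) eq)
  ... | tri≈ _ e _   = e
  ... | tri> _ _ j<i = ⊥-elim (ℕₚ.<⇒≢ (ℕₚ.^-monoʳ-< q 1<q j<i) (sym eq))

  cons : k → (Fin n → k) → Fin (suc n) → k
  cons x v zero    = x
  cons x v (suc i) = v i

  count-cons : {P : k → Set} {Q : (Fin n → k) → Set} → Count scalars P m → Count (vectors n) Q N →
    (∀ {u v} → (∀ i → u i ≡ v i) → Q u → Q v) →
    Count (vectors (suc n)) (λ v → P (v zero) × Q (v ∘ suc)) (m * N)
  count-cons {n = n} c d Q-resp = Count-map (record
    { to = uncurry cons ; from = λ v → v zero , v ∘ suc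
    ; to-cong = λ { (e , f) zero → e ; (e , f) (suc i) → f i } ; from-cong = λ e → e zero , e ∘ suc
    ; to-mem = id ; from-mem = id
    ; from∘to = λ _ → refl , λ _ → refl ; to∘from = λ { _ zero → refl ; _ (suc i) → refl } })
    (Count-× scalars (vectors n) c d)

  count-vectors : ∀ n → Count (vectors n) (λ _ → ⊤) (q ^ n)
  count-vectors zero    = Count-single (vectors 0) (λ ()) tt (λ _ ())
  count-vectors (suc n) = Count-resp (vectors (suc n)) (λ _ → tt) (λ _ → tt , tt)
    (count-cons count-scalars (count-vectors n) _)

  Supported : (Fin n → Bool) → (Fin n → k) → Set
  Supported b v = ∀ i → b i ≡ false → v i ≡ 0#

  count-supported : (b : Fin n → Bool) → Count (vectors n) (Supported b) (q ^ countᵇ b)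
  count-supported {zero}  b = Count-single (vectors 0) (λ ()) (λ ()) (λ _ ())
  count-supported {suc n} b with b zero in eq
  ... | true = Count-resp (vectors (suc n))
    (λ { (_ , s) zero e → ⊥-elim (true≢false (trans (sym eq) e)) ; (_ , s) (suc i) e → s i e })
    (λ s → tt , s ∘ suc)
    (count-cons count-scalars (count-supported (b ∘ suc)) λ e s i z → trans (sym (e i)) (s i z))
    where
    true≢false : true ≢ false
    true≢false ()
  ... | false = subst (Count (vectors (suc n)) (Supported b)) (ℕₚ.+-identityʳ _) (Count-resp (vectors (suc n))
    (λ { (z , s) zero e → z ; (_ , s) (suc i) e → s i e })
    (λ s → s zero eq , s ∘ suc)
    (count-cons count-zero (count-supported (b ∘ suc)) λ e s i z → trans (sym (e i)) (s i z)))

  Nonzero : (Fin n → k) → Set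
  Nonzero v = ∃ λ i → v i ≢ 0#

  Nonzero? : (v : Fin n → k) → Dec (Nonzero v)
  Nonzero? v = Finₚ.any? λ i → ¬? (v i ≟ 0#)

  ¬Nonzero⇒0 : {v : Fin n → k} → ¬ Nonzero v → ∀ i → v i ≡ 0#
  ¬Nonzero⇒0 {v = v} nz i with v i ≟ 0#
  ... | yes e = e
  ... | no ne = ⊥-elim (nz (i , ne))

  -- This is q ^ n - 1, in the form in which `count-nonzero` meets it: the first entry is a unit, or
  -- it is 0 and the rest is nonzero.
  nz : ℕ → ℕ
  nz zero    = 0
  nz (suc n) = q⁻ * q ^ n + 1 * nz n

  suc-nz : ∀ n → suc (nz n) ≡ q ^ n
  suc-nz zero    = refl
  suc-nz (suc n) = begin
    suc (q⁻ * q ^ n + 1 * nz n)   ≡⟨ cong (λ z → suc (q⁻ * q ^ n + z)) (ℕₚ.*-identityˡ (nz n)) ⟩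
    suc (q⁻ * q ^ n + nz n)       ≡⟨ ℕₚ.+-suc _ (nz n) ⟨
    q⁻ * q ^ n + suc (nz n)       ≡⟨ cong (q⁻ * q ^ n +_) (suc-nz n) ⟩
    q⁻ * q ^ n + q ^ n            ≡⟨ ℕₚ.+-comm _ (q ^ n) ⟩
    suc q⁻ * q ^ n                ≡⟨ cong (_* q ^ n) suc-q⁻ ⟩
    q ^ suc n                     ∎ where open ≡-Reasoning

  count-nonzero : ∀ n → Count (vectors n) Nonzero (nz n)
  count-nonzero zero    = Count-empty (vectors 0) λ { (() , _) }
  count-nonzero (suc n) = Count-resp (vectors (suc n))
    (λ { (inj₁ (ne , _)) → zero , ne ; (inj₂ (_ , i , ne)) → suc i , ne }) split
    (Count-⊎ (vectors (suc n)) (λ eq (ne , _) (e , _) → ne (trans (eq zero) e))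
      (count-cons count-units (count-vectors n) _)
      (count-cons count-zero (count-nonzero n) λ eq (i , ne) → i , subst (_≢ 0#) (eq i) ne))
    where
    split : ∀ {v} → Nonzero v → (v zero ≢ 0# × ⊤) ⊎ (v zero ≡ 0# × Nonzero (v ∘ suc))
    split {v} (i , ne) with v zero ≟ 0#
    split (zero  , ne) | yes e = ⊥-elim (ne e)
    split (suc i , ne) | yes e = inj₂ (e , i , ne)
    ... | no ne₀ = inj₁ (ne₀ , tt)

  -- Kernels and coranks

  infixr 7 _·_
  _·_ : Matrix n → (Fin n → k) → Fin n → k
  (M · x) i = Σ' λ j → M i j ⊗ x j

  Ker : Matrix n → (Fin n → k) → Set
  Ker M x = ∀ i → (M · x) i ≡ 0#

  -- Being a mere count, the corank is carried along by any bijection of kernels, with no need to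
  -- check linearity.
  Corank : Matrix n → ℕ → Set
  Corank {n} M c = Count (vectors n) (Ker M) (q ^ c)

  Ker? : (M : Matrix n) → ∀ x → Dec (Ker M x)
  Ker? M x = Finₚ.all? λ i → (M · x) i ≟ 0#

  Ker-resp : (M : Matrix n) {x y : Fin n → k} → (∀ i → x i ≡ y i) → Ker M x → Ker M y
  Ker-resp M eq kx i = trans (Σ-cong λ j → cong (M i j ⊗_) (sym (eq j))) (kx i)

  Ker-cong : {M M′ : Matrix n} → (∀ i j → M i j ≡ M′ i j) → ∀ {x} → Ker M x → Ker M′ x
  Ker-cong eq {x} kx i = trans (Σ-cong λ j → cong (_⊗ x j) (sym (eq i j))) (kx i)

  Corank-cong : {M M′ : Matrix n} {c : ℕ} → (∀ i j → M i j ≡ M′ i j) → Corank M c → Corank M′ c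
  Corank-cong {n} eq = Count-resp (vectors n) (Ker-cong eq) (Ker-cong λ i j → sym (eq i j))

  Corank-unique : {M : Matrix n} {c d : ℕ} → Corank M c → Corank M d → c ≡ d
  Corank-unique {n} C D = q^-injective (Count-unique (vectors n) id id C D)

  Corank-permute : (π : Permutation′ n) {M : Matrix n} {c : ℕ} → Corank M c →
                   Corank (λ i j → M (π ⟨$⟩ʳ i) (π ⟨$⟩ʳ j)) c
  Corank-permute π {M} = Count-map record
    { to = _∘ (π ⟨$⟩ʳ_) ; from = _∘ (π ⟨$⟩ˡ_)
    ; to-cong = λ e i → e (π ⟨$⟩ʳ i) ; from-cong = λ e i → e (π ⟨$⟩ˡ i)
    ; to-mem = λ {x} kx i → trans (Σ-permute (λ j → M (π ⟨$⟩ʳ i) j ⊗ x j) π) (kx (π ⟨$⟩ʳ i))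
    ; from-mem = λ {y} ky i → trans (trans (sym (Σ-permute (λ j → M i j ⊗ y (π ⟨$⟩ˡ j)) π))
        (Σ-cong λ j → cong₂ _⊗_ (cong (λ z → M z (π ⟨$⟩ʳ j)) (sym (Perm.inverseʳ π)))
                                (cong y (Perm.inverseˡ π))))
        (ky (π ⟨$⟩ˡ i))
    ; from∘to = λ {x} _ i → cong x (Perm.inverseʳ π)
    ; to∘from = λ {y} _ i → cong y (Perm.inverseˡ π) }

  Σ-single : (f : Fin n → k) (l : Fin n) → (∀ j → j ≢ l → f j ≡ 0#) → Σ' f ≡ f l
  Σ-single f zero    h = trans (cong (f zero ⊕_) (Σ-0 λ j → h (suc j) λ ())) (+-identityʳ _)
  Σ-single f (suc l) h = trans (cong₂ _⊕_ (h zero λ ())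
    (Σ-single (f ∘ suc) l λ j j≢l → h (suc j) (j≢l ∘ Finₚ.suc-injective))) (+-identityˡ _)

  Ker-Σ : (M : Matrix n) (t : Fin m → k) (b : Fin m → Fin n → k) → (∀ j → Ker M (b j)) →
          Ker M (λ l → Σ' λ j → t j ⊗ b j l)
  Ker-Σ M t b kb i = begin
    Σ' (λ l → M i l ⊗ Σ' (λ j → t j ⊗ b j l))     ≡⟨ Σ-cong (λ l → sym (Σ-*ˡ (M i l) (λ j → t j ⊗ b j l))) ⟩
    Σ' (λ l → Σ' (λ j → M i l ⊗ (t j ⊗ b j l)))   ≡⟨ Σ-comm (λ l j → M i l ⊗ (t j ⊗ b j l)) ⟩
    Σ' (λ j → Σ' (λ l → M i l ⊗ (t j ⊗ b j l)))   ≡⟨ Σ-0 (λ j → trans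
      (Σ-cong λ l → solve 3 (λ a b c → a :* (b :* c) := b :* (a :* c)) refl (M i l) (t j) (b j l))
      (trans (Σ-*ˡ (t j) (λ l → M i l ⊗ b j l)) (trans (cong (t j ⊗_) (kb j i)) (zeroʳ _)))) ⟩
    0#                                            ∎ where open ≡-Reasoning

  Ker-+* : (M : Matrix n) {x y : Fin n → k} (a : k) → Ker M x → Ker M y → Ker M (λ i → x i ⊕ a ⊗ y i)
  Ker-+* M {x} {y} a kx ky i = begin
    Σ' (λ j → M i j ⊗ (x j ⊕ a ⊗ y j))   ≡⟨ Σ-cong (λ j → solve 4 (λ m x a y → m :* (x :+ a :* y) := m :* x :+ a :* (m :* y)) refl (M i j) (x j) a (y j)) ⟩
    Σ' (λ j → M i j ⊗ x j ⊕ a ⊗ (M i j ⊗ y j))  ≡⟨ Σ-+ (λ j → M i j ⊗ x j) (λ j → a ⊗ (M i j ⊗ y j)) ⟩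
    (M · x) i ⊕ Σ' (λ j → a ⊗ (M i j ⊗ y j))    ≡⟨ cong₂ _⊕_ (kx i) (trans (Σ-*ˡ a (λ j → M i j ⊗ y j)) (cong (a ⊗_) (ky i))) ⟩
    0# ⊕ a ⊗ 0#                          ≡⟨ solve 1 (λ a → :0 :+ a :* :0 := :0) refl a ⟩
    0#                                   ∎ where open ≡-Reasoning

  -- Rank in terms of the size of the kernel

  countᵇ-∁ : (S : Subset n) → countᵇ (not ∘ lookup S) + ∣ S ∣ ≡ n
  countᵇ-∁ []          = refl
  countᵇ-∁ (true ∷ S)  = trans (ℕₚ.+-suc _ ∣ S ∣) (cong suc (countᵇ-∁ S))
  countᵇ-∁ (false ∷ S) = cong suc (countᵇ-∁ S)

  module _ (M : Mat n) where

    entries : Matrix n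
    entries i j = M [ i , j ]

    Dependence : Subset n → (Fin n → k) → Set
    Dependence S c = (∀ j → j ∉ S → c j ≡ 0#) × Ker entries c × Nonzero c

    dependence? : ∀ S → Dec (∃ (Dependence S))
    dependence? S = map′ (λ (c , _ , d) → c , d) (λ (c , d) → c , tt , d)
      (Count-search (vectors n) (count-vectors n)
        (λ eq (s , kc , i , ne) → (λ j j∉ → trans (sym (eq j)) (s j j∉)) , Ker-resp entries eq kc , i , ne ∘ trans (eq i))
        (λ c → Finₚ.all? (λ j → ¬? (j Subsetₚ.∈? S) →-dec (c j ≟ 0#)) ×-dec (Ker? entries c ×-dec Nonzero? c)))

    independent : ∀ {S} → ¬ ∃ (Dependence S) → LinIndepCols M S
    independent ¬d c s kc = ¬Nonzero⇒0 λ nz → ¬d (c , s , kc , nz)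

    LinIndepCols? : ∀ S → Dec (LinIndepCols M S)
    LinIndepCols? S with dependence? S
    ... | no ¬d = yes (independent ¬d)
    ... | yes (c , s , kc , i , ne) = no λ li → ne (li c s kc i)

    module _ {S : Subset n} (li : LinIndepCols M S) (max : ∀ T → LinIndepCols M T → ∣ T ∣ ≤ ∣ S ∣) where

      -- The unique kernel vector with support in S ∪ {j} and entry 1 at j.
      relation : ∀ j → j ∉ S → ∃ λ b → (∀ l → l ∉ S → l ≢ j → b l ≡ 0#) × Ker entries b × b j ≡ 1#
      relation j j∉S with dependence? (S ∪ ⁅ j ⁆)
      -- Without a dependence, S ∪ {j} would be an independent set larger than S.
      ... | no ¬d = ⊥-elim (ℕₚ.<⇒≱ (Subsetₚ.p⊂q⇒∣p∣<∣q∣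
              (Subsetₚ.p⊆p∪q ⁅ j ⁆ , j , Subsetₚ.q⊆p∪q S ⁅ j ⁆ (Subsetₚ.x∈⁅x⁆ j) , j∉S))
              (max (S ∪ ⁅ j ⁆) (independent ¬d)))
      ... | yes (c , s , kc , i , ne) with c j ≟ 0#
      -- A dependence vanishing at j would be supported in S, against the independence of S.
      ...   | yes z = ⊥-elim (ne (li c supp kc i))
        where
        supp : ∀ l → l ∉ S → c l ≡ 0#
        supp l l∉S with l Fin.≟ j
        ... | yes refl = z
        ... | no l≢j = s l ([ l∉S , l≢j ∘ Subsetₚ.x∈⁅y⁆⇒x≡y j ]′ ∘ Subsetₚ.x∈p∪q⁻ S ⁅ j ⁆)
      ...   | no nz with inverse (c j) nz
      ...     | y , cy = (λ l → c l ⊗ y)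
        , (λ l l∉S l≢j → trans (cong (_⊗ y) (s l ([ l∉S , l≢j ∘ Subsetₚ.x∈⁅y⁆⇒x≡y j ]′ ∘ Subsetₚ.x∈p∪q⁻ S ⁅ j ⁆))) (zeroˡ y))
        , (λ i → trans (Σ-cong λ l → solve 3 (λ a b c → a :* (b :* c) := c :* (a :* b)) refl (entries i l) (c l) y)
            (trans (Σ-*ˡ y (λ l → entries i l ⊗ c l)) (trans (cong (y ⊗_) (kc i)) (zeroʳ y))))
        , cy

      -- The value 0 for j in S lets the sum in `extend` run over all indices.
      basis : Fin n → Fin n → k
      basis j with j Subsetₚ.∈? S
      ... | yes _ = λ _ → 0#
      ... | no j∉S = proj₁ (relation j j∉S)

      basis-Ker : ∀ j → Ker entries (basis j)
      basis-Ker j with j Subsetₚ.∈? S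
      ... | yes _ = λ i → Σ-0 λ l → zeroʳ (entries i l)
      ... | no j∉S = proj₁ (proj₂ (proj₂ (relation j j∉S)))

      basis-off : ∀ j l → l ∉ S → j ≢ l → basis j l ≡ 0#
      basis-off j l l∉S j≢l with j Subsetₚ.∈? S
      ... | yes _ = refl
      ... | no j∉S = proj₁ (proj₂ (relation j j∉S)) l l∉S (j≢l ∘ sym)

      basis-diag : ∀ j → j ∉ S → basis j j ≡ 1#
      basis-diag j j∉S with j Subsetₚ.∈? S
      ... | yes j∈S = ⊥-elim (j∉S j∈S)
      ... | no j∉S′ = proj₂ (proj₂ (proj₂ (relation j j∉S′)))

      extend : (Fin n → k) → Fin n → k
      extend t l = Σ' λ j → t j ⊗ basis j l

      extend-off : ∀ t l → l ∉ S → extend t l ≡ t l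
      extend-off t l l∉S = trans
        (Σ-single (λ j → t j ⊗ basis j l) l (λ j j≢l → trans (cong (t j ⊗_) (basis-off j l l∉S j≢l)) (zeroʳ _)))
        (trans (cong (t l ⊗_) (basis-diag l l∉S)) (*-identityʳ _))

      restrict : (Fin n → k) → Fin n → k
      restrict x j = if lookup S j then 0# else x j

      restrict-off : ∀ x j → j ∉ S → restrict x j ≡ x j
      restrict-off x j j∉S with lookup S j in eq
      ... | true  = ⊥-elim (j∉S (Vecₚ.lookup⇒[]= j S eq))
      ... | false = refl

      -- A kernel vector may be prescribed arbitrarily outside S and is then determined: the
      -- difference of x and the extension of its restriction is a kernel vector supported in S,
      -- hence 0.
      independent-kernel-bijection : Bijection (vectors n) (vectors n) (Ker entries) (Supported (not ∘ lookup S))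
      independent-kernel-bijection = record
        { to = restrict
        ; from = extend
        ; to-cong = λ e j → cong (if lookup S j then 0# else_) (e j)
        ; from-cong = λ e l → Σ-cong λ j → cong (_⊗ basis j l) (e j)
        ; to-mem = λ {x} _ → to-mem x
        ; from-mem = λ {t} _ → Ker-Σ entries t basis basis-Ker
        ; from∘to = λ {x} kx l → trans (solve 2 (λ y x → y := (y :+ :- :1 :* x) :+ x) refl (extend (restrict x) l) (x l))
            (trans (cong (_⊕ x l) (li _
              (λ j j∉S → trans (cong (_⊕ _) (trans (extend-off (restrict x) j j∉S) (restrict-off x j j∉S)))
                (solve 1 (λ x → x :+ :- :1 :* x := :0) refl (x j)))
              (Ker-+* entries (⊖ 1#) (Ker-Σ entries (restrict x) basis basis-Ker) kx) l)) (+-identityˡ _))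
        ; to∘from = λ {t} st → to∘from t st }
        where
        to-mem : ∀ x j → not (lookup S j) ≡ false → restrict x j ≡ 0#
        to-mem x j e with lookup S j
        to-mem x j refl | true = refl
        to∘from : ∀ t → Supported (not ∘ lookup S) t → ∀ j → restrict (extend t) j ≡ t j
        to∘from t st j with lookup S j in eq
        ... | true  = sym (st j (cong not eq))
        ... | false = extend-off t j λ j∈S → true≢false (trans (sym (Vecₚ.[]=⇒lookup j∈S)) eq)
          where
          true≢false : true ≢ false
          true≢false ()

    -- The free coordinates of the kernel are those outside a largest independent set of columns, n
    -- - r in number.
    rank⇒corank : ∀ {r c} → HasRank M r → c + r ≡ n → Corank entries c
    rank⇒corank {c = c} ((S , li , refl) , max) eq = subst (λ z → Count (vectors n) (Ker entries) (q ^ z))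
      (ℕₚ.+-cancelʳ-≡ ∣ S ∣ _ c (trans (countᵇ-∁ S) (sym eq)))
      (Count-map (reverse (independent-kernel-bijection li max)) (count-supported (not ∘ lookup S)))

    rank-≤ : ∀ {r} → HasRank M r → r ≤ n
    rank-≤ ((S , _ , refl) , _) = Subsetₚ.∣p∣≤n S

    -- A downward search: a bound that no independent set attains can be lowered by one, and at 0
    -- the empty set attains it.
    rank-below : ∀ m → (∀ S → LinIndepCols M S → ∣ S ∣ ≤ m) → ∃ (HasRank M)
    rank-below m ub with Subsetₚ.anySubset? (λ S → LinIndepCols? S ×-dec (∣ S ∣ ℕ.≟ m))
    ... | yes (S , li , e) = m , (S , li , e) , ub
    rank-below zero    ub | no ¬S = ⊥-elim (¬S (Subset.⊥ , (λ c s _ j → s j Subsetₚ.∉⊥) , Subsetₚ.∣⊥∣≡0 n))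
    rank-below (suc m) ub | no ¬S = rank-below m λ S li →
      ℕₚ.≤-pred (ℕₚ.≤∧≢⇒< (ub S li) λ e → ¬S (S , li , e))

    -- Some rank r₀ exists by search; it gives the corank n - r₀, which must be c.
    corank⇒rank : ∀ {r c} → Corank entries c → c + r ≡ n → HasRank M r
    corank⇒rank {r} {c} C eq with r₀ , R ← rank-below n (λ S _ → Subsetₚ.∣p∣≤n S) =
      subst (HasRank M) (ℕₚ.+-cancelˡ-≡ c _ _ (trans (cong (_+ r₀) (Corank-unique C
        (rank⇒corank R (ℕₚ.m∸n+n≡m (rank-≤ R))))) (trans (ℕₚ.m∸n+n≡m (rank-≤ R)) (sym eq)))) R

  -- Symmetric and alternating matrices under one roof

  -- `ε` is the sign under transposition, `D` the set of admissible diagonal entries. The expression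
  -- in `D-mix` is a diagonal entry after the elimination, so `D-mix` says that congruence respects
  -- the diagonal condition.
  record Kind : Set₁ where
    field
      ε     : k
      ε⊗ε   : ε ⊗ ε ≡ 1#
      D     : k → Set
      D-mix : ∀ {a b c} x y → D a → D c → D (a ⊕ (x ⊗ b ⊕ x ⊗ (ε ⊗ b)) ⊕ y ⊗ c)
      D-ε   : ∀ {a} → D a → a ≡ ε ⊗ a
      D-0   : D 0#
      #D    : ℕ
      count-D : Count scalars D #D

  symmetric : Kind
  symmetric = record
    { ε = 1# ; ε⊗ε = *-identityˡ 1# ; D = λ _ → ⊤ ; D-mix = λ _ _ _ _ → tt
    ; D-ε = λ _ → sym (*-identityˡ _) ; D-0 = tt
    ; #D = q ; count-D = count-scalars }

  alternating : Kind
  alternating = record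
    { ε = ⊖ 1# ; ε⊗ε = solve 0 (:- :1 :* :- :1 := :1) refl
    ; D = _≡ 0#
    ; D-mix = λ { {b = b} x y refl refl →
        solve 3 (λ b x y → :0 :+ (x :* b :+ x :* (:- :1 :* b)) :+ y :* :0 := :0) refl b x y }
    ; D-ε = λ { refl → sym (zeroʳ _) }
    ; D-0 = refl ; #D = 1 ; count-D = count-zero }

  record Good (κ : Kind) {n : ℕ} (F : Diagram n) (c : ℕ) (M : Matrix n) : Set where
    open Kind κ
    field
      transp : ∀ i j → M i j ≡ ε ⊗ M j i
      diag   : ∀ i → D (M i i)
      supp   : ∀ i j → F i j ≡ false → M i j ≡ 0#
      corank : Corank M c
  open Good

  Fibre : (κ : Kind) → Diagram (suc n) → ℕ → (Fin (suc n) → k) → Matrix (suc n) → Set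
  Fibre κ F c v M = Good κ F c M × (∀ i → M i zero ≡ v i)

  Good-permute : ∀ {κ F c M} (π : Permutation′ n) → Good κ F c M →
    Good κ (λ i j → F (π ⟨$⟩ʳ i) (π ⟨$⟩ʳ j)) c (λ i j → M (π ⟨$⟩ʳ i) (π ⟨$⟩ʳ j))
  Good-permute {c = c} π g = record
    { transp = λ i j → transp g _ _ ; diag = λ i → diag g _ ; supp = λ i j → supp g _ _
    ; corank = Corank-permute π {c = c} (corank g) }

  pattern 0F = zero
  pattern 1F = suc zero
  pattern ι i = suc (suc i)

  -- Elimination with pivots (0, 1) and (1, 0)

  -- Eliminating rows and columns 0 and 1 of a matrix whose column 0 is v, where v 0 = 0 and v 1 is
  -- invertible.
  module Eliminate (κ : Kind) {m : ℕ} (v : Fin (2 + m) → k) (v₀ : v 0F ≡ 0#)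
                   (v₁⁻¹ : k) (v₁-inv : v 1F ⊗ v₁⁻¹ ≡ 1#) where
    open Kind κ

    u : Fin m → k
    u i = v (ι i) ⊗ v₁⁻¹

    v≡v₁u : ∀ i → v (ι i) ≡ v 1F ⊗ u i
    v≡v₁u i = sym (trans (solve 3 (λ x y z → x :* (y :* z) := (x :* z) :* y) refl (v 1F) (v (ι i)) v₁⁻¹)
      (trans (cong (_⊗ v (ι i)) v₁-inv) (*-identityˡ _)))

    -- Subtracting u i times row 1 from row i, and likewise for columns, makes column 0 and row 0
    -- vanish off the pivots. Rows and columns 0 then clear row and column 1 without changing the
    -- remaining block, which is this one.
    reduce : Matrix (2 + m) → Matrix m
    reduce M i j = M (ι i) (ι j) ⊕ (⊖ u i ⊗ M 1F (ι j) ⊕ ⊖ u j ⊗ M (ι i) 1F) ⊕ u i ⊗ u j ⊗ M 1F 1F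

    -- The inverse of `reduce`, once it is told what `reduce` forgets: the diagonal entry `δ` and
    -- the remaining entries `w` of row 1.
    build : k → (Fin m → k) → Matrix m → Matrix (2 + m)
    build δ w N 0F     0F     = 0#
    build δ w N 0F    (suc j) = ε ⊗ v (suc j)
    build δ w N (suc i) 0F    = v (suc i)
    build δ w N 1F     1F     = δ
    build δ w N 1F     (ι j)  = w j
    build δ w N (ι i)  1F     = ε ⊗ w i
    build δ w N (ι i)  (ι j)  = N i j ⊕ (u i ⊗ w j ⊕ u j ⊗ (ε ⊗ w i)) ⊕ ⊖ (u i ⊗ u j) ⊗ δ

    reduce-build : ∀ δ w N i j → reduce (build δ w N) i j ≡ N i j
    reduce-build δ w N i j = solve 7 (λ n ui uj wj wi d e →
      (n :+ (ui :* wj :+ uj :* (e :* wi)) :+ :- (ui :* uj) :* d) :+ (:- ui :* wj :+ :- uj :* (e :* wi)) :+ ui :* uj :* d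
        := n) refl (N i j) (u i) (u j) (w j) (w i) δ ε

    tail₂ : (Fin (2 + m) → k) → Fin m → k
    tail₂ x i = x (ι i)

    module Kernel (M : Matrix (2 + m)) (row₀ : ∀ j → M 0F j ≡ ε ⊗ v j) (col₀ : ∀ i → M i 0F ≡ v i) where

      A : (Fin m → k) → Fin m → k
      A y i = Σ' λ j → M (ι i) (ι j) ⊗ y j

      B U : (Fin m → k) → k
      B y = Σ' λ j → M 1F (ι j) ⊗ y j
      U y = Σ' λ j → u j ⊗ y j

      reduce-· : ∀ y i → (reduce M · y) i ≡
        A y i ⊕ (⊖ u i ⊗ B y ⊕ (⊖ M (ι i) 1F ⊕ u i ⊗ M 1F 1F) ⊗ U y)
      reduce-· y i = begin
        Σ' (λ j → reduce M i j ⊗ y j)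
          ≡⟨ Σ-cong (λ j → solve 7 (λ a b c d ui uj y →
               (a :+ (:- ui :* b :+ :- uj :* c) :+ ui :* uj :* d) :* y
               := a :* y :+ (:- ui :* (b :* y) :+ (:- c :+ ui :* d) :* (uj :* y))) refl
               (M (ι i) (ι j)) (M 1F (ι j)) (M (ι i) 1F) (M 1F 1F) (u i) (u j) (y j)) ⟩
        Σ' (λ j → a j ⊕ (p ⊗ b j ⊕ r ⊗ c j))
          ≡⟨ Σ-+ a (λ j → p ⊗ b j ⊕ r ⊗ c j) ⟩
        A y i ⊕ Σ' (λ j → p ⊗ b j ⊕ r ⊗ c j)
          ≡⟨ cong (A y i ⊕_) (trans (Σ-+ (λ j → p ⊗ b j) (λ j → r ⊗ c j)) (cong₂ _⊕_ (Σ-*ˡ p b) (Σ-*ˡ r c))) ⟩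
        A y i ⊕ (p ⊗ B y ⊕ r ⊗ U y) ∎
        where
        open ≡-Reasoning
        p = ⊖ u i
        r = ⊖ M (ι i) 1F ⊕ u i ⊗ M 1F 1F
        a b c : Fin m → k
        a j = M (ι i) (ι j) ⊗ y j
        b j = M 1F (ι j) ⊗ y j
        c j = u j ⊗ y j

      row0-· : ∀ x → (M · x) 0F ≡ ε ⊗ v 1F ⊗ (x 1F ⊕ U (tail₂ x))
      row0-· x = begin
        M 0F 0F ⊗ x 0F ⊕ (M 0F 1F ⊗ x 1F ⊕ Σ' (λ j → M 0F (ι j) ⊗ x (ι j)))
          ≡⟨ cong₂ _⊕_ (cong (_⊗ x 0F) (trans (col₀ 0F) v₀))
               (cong₂ _⊕_ (cong (_⊗ x 1F) (row₀ 1F))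
                 (trans (Σ-cong λ j → trans (cong (_⊗ x (ι j)) (trans (row₀ (ι j)) (cong (ε ⊗_) (v≡v₁u j))))
                   (solve 4 (λ e a b c → e :* (a :* b) :* c := e :* a :* (b :* c)) refl ε (v 1F) (u j) (x (ι j))))
                   (Σ-*ˡ (ε ⊗ v 1F) (λ j → u j ⊗ x (ι j))))) ⟩
        0# ⊗ x 0F ⊕ (ε ⊗ v 1F ⊗ x 1F ⊕ ε ⊗ v 1F ⊗ U (tail₂ x))
          ≡⟨ solve 4 (λ x0 a x1 s → :0 :* x0 :+ (a :* x1 :+ a :* s) := a :* (x1 :+ s)) refl (x 0F) (ε ⊗ v 1F) (x 1F) (U (tail₂ x)) ⟩
        ε ⊗ v 1F ⊗ (x 1F ⊕ U (tail₂ x)) ∎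
        where open ≡-Reasoning

      row1-· : ∀ x → (M · x) 1F ≡ v 1F ⊗ x 0F ⊕ (M 1F 1F ⊗ x 1F ⊕ B (tail₂ x))
      row1-· x = cong (λ z → z ⊗ x 0F ⊕ (M 1F 1F ⊗ x 1F ⊕ B (tail₂ x))) (col₀ 1F)

      rowι-· : ∀ x i → (M · x) (ι i) ≡ v 1F ⊗ u i ⊗ x 0F ⊕ (M (ι i) 1F ⊗ x 1F ⊕ A (tail₂ x) i)
      rowι-· x i = cong (λ z → z ⊗ x 0F ⊕ (M (ι i) 1F ⊗ x 1F ⊕ A (tail₂ x) i)) (trans (col₀ (ι i)) (v≡v₁u i))

      -- Row i of the reduced matrix is row i minus u i times row 1, corrected by a multiple of row 0.
      row-combination : ∀ x i → (M · x) (ι i) ≡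
        (reduce M · (tail₂ x)) i ⊕ ((M · x) 1F ⊗ u i ⊕ (x 1F ⊕ U (tail₂ x)) ⊗ (M (ι i) 1F ⊕ ⊖ u i ⊗ M 1F 1F))
      row-combination x i = begin
        (M · x) (ι i)
          ≡⟨ rowι-· x i ⟩
        v 1F ⊗ u i ⊗ x 0F ⊕ (M (ι i) 1F ⊗ x 1F ⊕ A y i)
          ≡⟨ identity (A y i) (B y) (U y) (M 1F 1F) (x 1F) (u i) (M (ι i) 1F) (x 0F) (v 1F) ⟩
        (A y i ⊕ (⊖ u i ⊗ B y ⊕ (⊖ M (ι i) 1F ⊕ u i ⊗ M 1F 1F) ⊗ U y)) ⊕
          ((v 1F ⊗ x 0F ⊕ (M 1F 1F ⊗ x 1F ⊕ B y)) ⊗ u i ⊕ (x 1F ⊕ U y) ⊗ (M (ι i) 1F ⊕ ⊖ u i ⊗ M 1F 1F))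
          ≡⟨ cong₂ (λ p q → p ⊕ (q ⊗ u i ⊕ (x 1F ⊕ U y) ⊗ (M (ι i) 1F ⊕ ⊖ u i ⊗ M 1F 1F)))
               (reduce-· y i) (row1-· x) ⟨
        (reduce M · y) i ⊕ ((M · x) 1F ⊗ u i ⊕ (x 1F ⊕ U y) ⊗ (M (ι i) 1F ⊕ ⊖ u i ⊗ M 1F 1F)) ∎
        where
        open ≡-Reasoning
        y = tail₂ x
        identity : ∀ a b U d x₁ u n x₀ v₁ → v₁ ⊗ u ⊗ x₀ ⊕ (n ⊗ x₁ ⊕ a) ≡
          (a ⊕ (⊖ u ⊗ b ⊕ (⊖ n ⊕ u ⊗ d) ⊗ U)) ⊕ ((v₁ ⊗ x₀ ⊕ (d ⊗ x₁ ⊕ b)) ⊗ u ⊕ (x₁ ⊕ U) ⊗ (n ⊕ ⊖ u ⊗ d))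
        identity = solve 9 (λ a b U d x₁ u n x₀ v₁ → v₁ :* u :* x₀ :+ (n :* x₁ :+ a) :=
          (a :+ (:- u :* b :+ (:- n :+ u :* d) :* U)) :+
            ((v₁ :* x₀ :+ (d :* x₁ :+ b)) :* u :+ (x₁ :+ U) :* (n :+ :- u :* d))) refl

      -- Row 0 forces coordinate 1 to be - U y, and row 1 can then be solved for coordinate 0, whose
      -- coefficient is v 1.
      lift : (Fin m → k) → Fin (2 + m) → k
      lift y 0F    = ⊖ v₁⁻¹ ⊗ (M 1F 1F ⊗ ⊖ U y ⊕ B y)
      lift y 1F    = ⊖ U y
      lift y (ι i) = y i

      -- Row 0 reads ε v₁ (x₁ + U) = 0, and ε v₁ has the inverse ε v₁⁻¹.
      x₁≡-U : ∀ {x} → Ker M x → x 1F ⊕ U (tail₂ x) ≡ 0#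
      x₁≡-U {x} kx = begin
        s                                     ≡⟨ *-identityˡ s ⟨
        1# ⊗ s                                ≡⟨ cong (_⊗ s) (trans (sym (*-identityˡ 1#)) (cong₂ _⊗_ (sym ε⊗ε) (sym v₁-inv))) ⟩
        ε ⊗ ε ⊗ (v 1F ⊗ v₁⁻¹) ⊗ s             ≡⟨ solve 4 (λ e a b s → e :* e :* (a :* b) :* s := e :* b :* (e :* a :* s)) refl ε (v 1F) v₁⁻¹ s ⟩
        ε ⊗ v₁⁻¹ ⊗ (ε ⊗ v 1F ⊗ s)             ≡⟨ cong (ε ⊗ v₁⁻¹ ⊗_) (trans (sym (row0-· x)) (kx 0F)) ⟩
        ε ⊗ v₁⁻¹ ⊗ 0#                         ≡⟨ zeroʳ _ ⟩
        0#                                    ∎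
        where
        open ≡-Reasoning
        s = x 1F ⊕ U (tail₂ x)

      a+[b+c]≡0 : ∀ {a b c : k} {x y} → b ≡ 0# → c ≡ 0# → a ≡ 0# → a ⊕ (b ⊗ x ⊕ c ⊗ y) ≡ 0#
      a+[b+c]≡0 {x = x} {y} refl refl refl =
        solve 2 (λ x y → :0 :+ (:0 :* x :+ :0 :* y) := :0) refl x y

      a+[b+c]≡0⇒a≡0 : ∀ {a b c : k} {x y} → b ≡ 0# → c ≡ 0# → a ⊕ (b ⊗ x ⊕ c ⊗ y) ≡ 0# → a ≡ 0#
      a+[b+c]≡0⇒a≡0 {a} {x = x} {y} refl refl eq = trans
        (solve 3 (λ a x y → a := a :+ (:0 :* x :+ :0 :* y)) refl a x y) eq

      row1-lift : ∀ y → (M · lift y) 1F ≡ 0#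
      row1-lift y = trans (row1-· (lift y)) (trans
        (solve 3 (λ a b s → a :* (:- b :* s) :+ s := (:1 :+ :- (a :* b)) :* s) refl (v 1F) v₁⁻¹ s)
        (trans (cong (_⊗ s) (trans (cong (λ z → 1# ⊕ ⊖ z) v₁-inv) (-‿inverseʳ 1#))) (zeroˡ s)))
        where s = M 1F 1F ⊗ ⊖ U y ⊕ B y

      -- By `row-combination`, once rows 0 and 1 annihilate x, each remaining row of M takes the
      -- same value on x as the reduced row on the tail.
      kernel-bijection : Bijection (vectors (2 + m)) (vectors m) (Ker M) (Ker (reduce M))
      kernel-bijection = record
        { to = tail₂
        ; from = lift
        ; to-cong = λ e i → e (ι i)
        ; from-cong = from-cong
        ; to-mem = λ {x} kx i → a+[b+c]≡0⇒a≡0 (kx 1F) (x₁≡-U {x} kx) (trans (sym (row-combination x i)) (kx (ι i)))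
        ; from-mem = λ {y} ky → λ
          { 0F → trans (row0-· (lift y)) (trans (cong (ε ⊗ v 1F ⊗_) (-U+U y)) (zeroʳ _))
          ; 1F → row1-lift y
          ; (ι i) → trans (row-combination (lift y) i) (a+[b+c]≡0 (row1-lift y) (-U+U y) (ky i)) }
        ; from∘to = λ {x} kx → λ
          { 0F → begin
              ⊖ v₁⁻¹ ⊗ (M 1F 1F ⊗ ⊖ U (tail₂ x) ⊕ B (tail₂ x))
                ≡⟨ solve 6 (λ c d U b v x0 → :- c :* (d :* :- U :+ b) := :- c :* (v :* x0 :+ (d :* :- U :+ b)) :+ v :* c :* x0)
                     refl v₁⁻¹ (M 1F 1F) (U (tail₂ x)) (B (tail₂ x)) (v 1F) (x 0F) ⟩
              ⊖ v₁⁻¹ ⊗ (v 1F ⊗ x 0F ⊕ (M 1F 1F ⊗ ⊖ U (tail₂ x) ⊕ B (tail₂ x))) ⊕ v 1F ⊗ v₁⁻¹ ⊗ x 0F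
                ≡⟨ cong₂ _⊕_ (cong (⊖ v₁⁻¹ ⊗_) (trans (cong (λ z → v 1F ⊗ x 0F ⊕ (M 1F 1F ⊗ z ⊕ B (tail₂ x))) (sym (x₁ {x} kx)))
                     (trans (sym (row1-· x)) (kx 1F)))) (cong (_⊗ x 0F) v₁-inv) ⟩
              ⊖ v₁⁻¹ ⊗ 0# ⊕ 1# ⊗ x 0F
                ≡⟨ solve 2 (λ c x → c :* :0 :+ :1 :* x := x) refl (⊖ v₁⁻¹) (x 0F) ⟩
              x 0F ∎
          ; 1F → sym (x₁ {x} kx)
          ; (ι i) → refl }
        ; to∘from = λ _ _ → refl }
        where
        open ≡-Reasoning
        U-cong : ∀ {y z : Fin m → k} → (∀ i → y i ≡ z i) → U y ≡ U z
        U-cong e = Σ-cong λ j → cong (u j ⊗_) (e j)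
        from-cong : ∀ {y z : Fin m → k} → (∀ i → y i ≡ z i) → ∀ i → lift y i ≡ lift z i
        from-cong e 0F    = cong (⊖ v₁⁻¹ ⊗_) (cong₂ _⊕_ (cong (λ z → M 1F 1F ⊗ ⊖ z) (U-cong e))
                                                        (Σ-cong λ j → cong (M 1F (ι j) ⊗_) (e j)))
        from-cong e 1F    = cong ⊖_ (U-cong e)
        from-cong e (ι i) = e i
        -U+U : ∀ y → ⊖ U y ⊕ U y ≡ 0#
        -U+U y = solve 1 (λ s → :- s :+ s := :0) refl (U y)
        x₁ : ∀ {x} → Ker M x → x 1F ≡ ⊖ U (tail₂ x)
        x₁ {x} kx = begin
          x 1F                    ≡⟨ solve 2 (λ a b → a := (a :+ b) :+ :- b) refl (x 1F) s ⟩
          (x 1F ⊕ s) ⊕ ⊖ s        ≡⟨ cong (_⊕ ⊖ s) (x₁≡-U {x} kx) ⟩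
          0# ⊕ ⊖ s                ≡⟨ +-identityˡ _ ⟩
          ⊖ s                     ∎ where s = U (tail₂ x)

    module _ {F : Diagram (2 + m)} (F-sym : ∀ i j → F i j ≡ F j i)
             (full : ∀ i → v i ≢ 0# → ∀ j → F i j ≡ true) where

      F′ : Diagram m
      F′ i j = F (ι i) (ι j)

      -- A row with a gap is not full, so its multiplier is 0; hence neither `reduce` nor `build`
      -- leaves the diagram.
      u-supp : ∀ i j → F′ i j ≡ false → u i ≡ 0#
      u-supp i j e with v (ι i) ≟ 0#
      ... | yes z = trans (cong (_⊗ v₁⁻¹) z) (zeroˡ _)
      ... | no nz with trans (sym e) (full (ι i) nz (ι j))
      ...   | ()

      v-supp : ∀ i j → F i j ≡ false → v i ≡ 0#
      v-supp i j e with v i ≟ 0#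
      ... | yes z = z
      ... | no nz with trans (sym e) (full i nz j)
      ...   | ()

      v₁≢0 : v 1F ≢ 0#
      v₁≢0 z = 0≢1 (trans (sym (zeroˡ v₁⁻¹)) (trans (cong (_⊗ v₁⁻¹) (sym z)) v₁-inv))

      row₁-full : ∀ j → F 1F j ≢ false
      row₁-full j e with trans (sym e) (full 1F v₁≢0 j)
      ... | ()

      module _ {M : Matrix (2 + m)} {c : ℕ} (g : Good κ F c M) (col₀ : ∀ i → M i 0F ≡ v i) where

        row₀ : ∀ j → M 0F j ≡ ε ⊗ v j
        row₀ j = trans (transp g 0F j) (cong (ε ⊗_) (col₀ j))

        reduce-good : Good κ F′ c (reduce M)
        reduce-good .transp i j = trans
          (cong₂ _⊕_ (cong₂ _⊕_ (transp g (ι i) (ι j))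
                                (cong₂ _⊕_ (cong (⊖ u i ⊗_) (transp g 1F (ι j))) (cong (⊖ u j ⊗_) (transp g (ι i) 1F))))
                     (cong (u i ⊗ u j ⊗_) (transp g 1F 1F)))
          (solve 7 (λ e a b c d x y → e :* a :+ (:- x :* (e :* b) :+ :- y :* (e :* c)) :+ x :* y :* (e :* d)
              := e :* (a :+ (:- y :* c :+ :- x :* b) :+ y :* x :* d)) refl
            ε (M (ι j) (ι i)) (M (ι j) 1F) (M 1F (ι i)) (M 1F 1F) (u i) (u j))
        -- The entry in column 1 is written as ε times its mirror image, to match the form of
        -- `D-mix`.
        reduce-good .diag i = subst (λ z → D (M (ι i) (ι i) ⊕ (⊖ u i ⊗ M 1F (ι i) ⊕ ⊖ u i ⊗ z) ⊕ u i ⊗ u i ⊗ M 1F 1F))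
          (sym (transp g (ι i) 1F)) (D-mix (⊖ u i) (u i ⊗ u i) (diag g (ι i)) (diag g 1F))
        reduce-good .supp i j e
          rewrite supp g (ι i) (ι j) e | u-supp i j e | u-supp j i (trans (F-sym (ι j) (ι i)) e) =
          solve 3 (λ a b c → :0 :+ (:- :0 :* a :+ :- :0 :* b) :+ :0 :* :0 :* c := :0) refl (M 1F (ι j)) (M (ι i) 1F) (M 1F 1F)
        reduce-good .corank = Count-map (Kernel.kernel-bijection M row₀ col₀) (corank g)

        build-reduce : ∀ i j → build (M 1F 1F) (λ j → M 1F (ι j)) (reduce M) i j ≡ M i j
        build-reduce 0F     0F      = sym (trans (col₀ 0F) v₀)
        build-reduce 0F     (suc j) = sym (row₀ (suc j))
        build-reduce (suc i) 0F     = sym (col₀ (suc i))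
        build-reduce 1F     1F      = refl
        build-reduce 1F     (ι j)   = refl
        build-reduce (ι i)  1F      = sym (transp g (ι i) 1F)
        build-reduce (ι i)  (ι j)   rewrite sym (transp g (ι i) 1F) =
          solve 6 (λ a b c d x y → (a :+ (:- x :* b :+ :- y :* c) :+ x :* y :* d) :+ (x :* b :+ y :* c) :+ :- (x :* y) :* d := a)
            refl (M (ι i) (ι j)) (M 1F (ι j)) (M (ι i) 1F) (M 1F 1F) (u i) (u j)

      module _ {δ : k} {w : Fin m → k} {N : Matrix m} {c : ℕ} (Dδ : D δ) (g : Good κ F′ c N) where

        εε : ∀ x → x ≡ ε ⊗ (ε ⊗ x)
        εε x = trans (sym (*-identityˡ x)) (trans (cong (_⊗ x) (sym ε⊗ε)) (*-assoc ε ε x))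

        build-transp : ∀ i j → build δ w N i j ≡ ε ⊗ build δ w N j i
        build-transp 0F      0F      = sym (zeroʳ ε)
        build-transp 0F      (suc j) = refl
        build-transp (suc i) 0F      = εε (v (suc i))
        build-transp 1F      1F      = D-ε Dδ
        build-transp 1F      (ι j)   = εε (w j)
        build-transp (ι i)   1F      = refl
        build-transp (ι i)   (ι j)   = trans
          (cong₂ _⊕_ (cong₂ _⊕_ (transp g i j) (cong₂ _⊕_ (cong (u i ⊗_) (εε (w j))) refl))
                     (cong (⊖ (u i ⊗ u j) ⊗_) (D-ε Dδ)))
          (solve 7 (λ e n x y s t d → e :* n :+ (x :* (e :* (e :* t)) :+ y :* (e :* s)) :+ :- (x :* y) :* (e :* d)
             := e :* (n :+ (y :* s :+ x :* (e :* t)) :+ :- (y :* x) :* d)) refl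
             ε (N j i) (u i) (u j) (w i) (w j) δ)

        build-row₀ : ∀ j → build δ w N 0F j ≡ ε ⊗ v j
        build-row₀ 0F      = sym (trans (cong (ε ⊗_) v₀) (zeroʳ ε))
        build-row₀ (suc j) = refl

        build-col₀ : ∀ i → build δ w N i 0F ≡ v i
        build-col₀ 0F      = sym v₀
        build-col₀ (suc i) = refl

        build-good : Good κ F c (build δ w N)
        build-good .transp = build-transp
        build-good .diag 0F    = D-0
        build-good .diag 1F    = Dδ
        build-good .diag (ι i) = D-mix (u i) (⊖ (u i ⊗ u i)) (diag g i) Dδ
        build-good .supp 0F      0F      e = refl
        build-good .supp 0F      (suc j) e = trans (cong (ε ⊗_) (v-supp (suc j) 0F (trans (F-sym (suc j) 0F) e))) (zeroʳ ε)
        build-good .supp (suc i) 0F      e = v-supp (suc i) 0F e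
        build-good .supp 1F      1F      e = ⊥-elim (row₁-full _ e)
        build-good .supp 1F      (ι j)   e = ⊥-elim (row₁-full _ e)
        build-good .supp (ι i)   1F      e = ⊥-elim (row₁-full _ (trans (F-sym 1F (ι i)) e))
        build-good .supp (ι i)   (ι j)   e
          rewrite supp g i j e | u-supp i j e | u-supp j i (trans (F-sym (ι j) (ι i)) e) =
          solve 3 (λ a b c → :0 :+ (:0 :* a :+ :0 :* b) :+ :- (:0 :* :0) :* c := :0) refl (w j) (ε ⊗ w i) δ
        build-good .corank = Count-map (reverse (Kernel.kernel-bijection (build δ w N) build-row₀ build-col₀))
          (Corank-cong {c = c} (λ i j → sym (reduce-build δ w N i j)) (corank g))

      -- Diagonal entry of row 1, rest of row 1 and reduced matrix vary independently: the row is
      -- full, so its entries are subject to the diagonal condition only.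
      fibre-bijection : ∀ c → Bijection (matrices (2 + m)) (×-setoid scalars (×-setoid (vectors m) (matrices m)))
        (Fibre κ F c v) (λ (δ , w , N) → D δ × ⊤ × Good κ F′ c N)
      fibre-bijection c = record
        { to = λ M → M 1F 1F , (λ j → M 1F (ι j)) , reduce M
        ; from = λ (δ , w , N) → build δ w N
        ; to-cong = λ e → e 1F 1F , (λ j → e 1F (ι j)) , λ i j →
            cong₂ _⊕_ (cong₂ _⊕_ (e (ι i) (ι j)) (cong₂ _⊕_ (cong (⊖ u i ⊗_) (e 1F (ι j))) (cong (⊖ u j ⊗_) (e (ι i) 1F))))
                      (cong (u i ⊗ u j ⊗_) (e 1F 1F))
        ; from-cong = λ (e , f , h) → λ
            { 0F 0F → refl ; 0F (suc j) → refl ; (suc i) 0F → refl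
            ; 1F 1F → e ; 1F (ι j) → f j ; (ι i) 1F → cong (ε ⊗_) (f i)
            ; (ι i) (ι j) → cong₂ _⊕_ (cong₂ _⊕_ (h i j) (cong₂ _⊕_ (cong (u i ⊗_) (f j)) (cong (λ z → u j ⊗ (ε ⊗ z)) (f i))))
                                      (cong (⊖ (u i ⊗ u j) ⊗_) e) }
        ; to-mem = λ (g , col₀) → diag g 1F , tt , reduce-good g col₀
        ; from-mem = λ (Dδ , _ , g) → build-good Dδ g , build-col₀ Dδ g
        ; from∘to = λ (g , col₀) → build-reduce g col₀
        ; to∘from = λ {(δ , w , N)} _ → refl , (λ _ → refl) , reduce-build δ w N }

      count-pivot-fibre : ∀ {c N} → Count (matrices m) (Good κ F′ c) N →
                          Count (matrices (2 + m)) (Fibre κ F c v) (#D * (q ^ m * N))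
      count-pivot-fibre {c} cnt = Count-map (reverse (fibre-bijection c))
        (Count-× _ _ count-D (Count-× _ _ (count-vectors m) cnt))

  -- Matrices whose column 0 vanishes

  module ZeroColumn (κ : Kind) {n : ℕ} {v : Fin (suc n) → k} (v-0 : ∀ i → v i ≡ 0#) where
    open Kind κ

    minor : Matrix (suc n) → Matrix n
    minor M i j = M (suc i) (suc j)

    pad : Matrix n → Matrix (suc n)
    pad N 0F      j       = 0#
    pad N (suc i) 0F      = 0#
    pad N (suc i) (suc j) = N i j

    module _ {M : Matrix (suc n)} (row₀ : ∀ j → M 0F j ≡ 0#) (col₀ : ∀ i → M i 0F ≡ 0#) where

      Ker-minor : ∀ {x} → Ker M x → Ker (minor M) (x ∘ suc)
      Ker-minor {x} kx i = trans (sym (trans (cong (_⊕ s) (trans (cong (_⊗ x 0F) (col₀ (suc i))) (zeroˡ _))) (+-identityˡ s)))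
        (kx (suc i))
        where s = Σ' λ j → M (suc i) (suc j) ⊗ x (suc j)

      Ker-unminor : ∀ {x} → Ker (minor M) (x ∘ suc) → Ker M x
      Ker-unminor {x} kx 0F      = Σ-0 λ j → trans (cong (_⊗ x j) (row₀ j)) (zeroˡ _)
      Ker-unminor {x} kx (suc i) = trans
        (trans (cong (_⊕ s) (trans (cong (_⊗ x 0F) (col₀ (suc i))) (zeroˡ _))) (+-identityˡ s)) (kx i)
        where s = Σ' λ j → M (suc i) (suc j) ⊗ x (suc j)

      count-Ker : ∀ {N} → Count (vectors n) (Ker (minor M)) N → Count (vectors (suc n)) (Ker M) (q * N)
      count-Ker c = Count-resp (vectors (suc n)) (λ {x} (_ , kx) → Ker-unminor {x} kx) (λ {x} kx → tt , Ker-minor {x} kx)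
        (count-cons count-scalars c λ {u} {v} → Ker-resp (minor M) {u} {v})

      -- Coordinate 0 of a kernel vector is free. That the kernel of the minor has a power of q as
      -- its size is not known beforehand, so an unspecified N is compared with q ^ c.
      count-Ker-minor : ∀ {c} → Corank M c → ∃ λ N → Count (vectors n) (Ker (minor M)) N × q * N ≡ q ^ c
      count-Ker-minor {c} C =
        let N , cnt = Count-filter (vectors n) (count-vectors n) (λ {u} {v} → Ker-resp (minor M) {u} {v}) (Ker? (minor M))
            cnt′ = Count-resp (vectors n) proj₂ (tt ,_) cnt
        in N , cnt′ , Count-unique (vectors (suc n)) id id (count-Ker cnt′) C

      corank-minor : ∀ {c} → Corank M (suc c) → Corank (minor M) c
      corank-minor {c} C =
        let N , cnt , eq = count-Ker-minor {suc c} C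
        in subst (Count (vectors n) (Ker (minor M))) (ℕₚ.*-cancelˡ-≡ N (q ^ c) q ⦃ ℕ.>-nonZero (ℕₚ.<⇒≤ 1<q) ⦄ eq) cnt

      -- Otherwise q would divide 1.
      corank-≢0 : ¬ Corank M 0
      corank-≢0 C = let N , _ , eq = count-Ker-minor {0} C in ℕₚ.<⇒≢ 1<q (sym (ℕₚ.m*n≡1⇒m≡1 q N eq))

    module _ {F : Diagram (suc n)} where

      fibre-row₀ : ∀ {c M} → Fibre κ F c v M → ∀ j → M 0F j ≡ 0#
      fibre-row₀ (g , col) j = trans (transp g 0F j) (trans (cong (ε ⊗_) (trans (col j) (v-0 j))) (zeroʳ ε))

      count-zero-fibre-invertible : Count (matrices (suc n)) (Fibre κ F 0 v) 0
      count-zero-fibre-invertible = Count-empty (matrices (suc n)) λ {M} f@(g , col) →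
        corank-≢0 {M} (fibre-row₀ {0} {M} f) (λ i → trans (col i) (v-0 i)) (corank g)

      count-zero-fibre : ∀ {c N} → Count (matrices n) (Good κ (λ i j → F (suc i) (suc j)) c) N →
                         Count (matrices (suc n)) (Fibre κ F (suc c) v) N
      count-zero-fibre {c} = Count-map (reverse (record
        { to = minor ; from = pad
        ; to-cong = λ e i j → e (suc i) (suc j)
        ; from-cong = λ e → λ { 0F _ → refl ; (suc i) 0F → refl ; (suc i) (suc j) → e i j }
        ; to-mem = λ {M} f@(g , col) → record
            { transp = λ i j → transp g (suc i) (suc j) ; diag = λ i → diag g (suc i)
            ; supp = λ i j → supp g (suc i) (suc j)
            ; corank = corank-minor {M} (fibre-row₀ {suc c} {M} f) (λ i → trans (col i) (v-0 i)) {c} (corank g) }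
        ; from-mem = λ {N} g → record
            { transp = λ { 0F 0F → sym (zeroʳ ε) ; 0F (suc j) → sym (zeroʳ ε) ; (suc i) 0F → sym (zeroʳ ε)
                         ; (suc i) (suc j) → transp g i j }
            ; diag = λ { 0F → D-0 ; (suc i) → diag g i }
            ; supp = λ { 0F j _ → refl ; (suc i) 0F _ → refl ; (suc i) (suc j) → supp g i j }
            ; corank = count-Ker {pad N} (λ _ → refl) (λ { 0F → refl ; (suc i) → refl }) (corank g) }
            , λ { 0F → sym (v-0 0F) ; (suc i) → sym (v-0 (suc i)) }
        ; from∘to = λ {M} f@(g , col) → λ
            { 0F j → sym (fibre-row₀ {suc c} {M} f j) ; (suc i) 0F → sym (trans (col (suc i)) (v-0 (suc i))) ; (suc i) (suc j) → refl }
        ; to∘from = λ _ _ _ → refl }))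

  -- Symmetric matrices with a nonzero corner

  module Schur {n : ℕ} (v : Fin (suc n) → k) (v₀⁻¹ : k) (v₀-inv : v 0F ⊗ v₀⁻¹ ≡ 1#) where
    
    u : Fin n → k
    u i = v (suc i) ⊗ v₀⁻¹

    v≡v₀u : ∀ i → v (suc i) ≡ v 0F ⊗ u i
    v≡v₀u i = sym (trans (solve 3 (λ x y z → x :* (y :* z) := (x :* z) :* y) refl (v 0F) (v (suc i)) v₀⁻¹)
      (trans (cong (_⊗ v (suc i)) v₀-inv) (*-identityˡ _)))

    complement : Matrix (suc n) → Matrix n
    complement M i j = M (suc i) (suc j) ⊕ ⊖ u i ⊗ v (suc j)

    build : Matrix n → Matrix (suc n)
    build N 0F      j       = v j
    build N (suc i) 0F      = v (suc i)
    build N (suc i) (suc j) = N i j ⊕ u i ⊗ v (suc j)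

    complement-build : ∀ N i j → complement (build N) i j ≡ N i j
    complement-build N i j = solve 3 (λ a b c → (a :+ b :* c) :+ :- b :* c := a) refl (N i j) (u i) (v (suc j))

    module Kernel (M : Matrix (suc n)) (row₀ : ∀ j → M 0F j ≡ v j) (col₀ : ∀ i → M i 0F ≡ v i) where

      V : (Fin n → k) → k
      V y = Σ' λ j → v (suc j) ⊗ y j

      V-cong : ∀ {y z : Fin n → k} → (∀ i → y i ≡ z i) → V y ≡ V z
      V-cong e = Σ-cong λ j → cong (v (suc j) ⊗_) (e j)

      row0-· : ∀ x → (M · x) 0F ≡ v 0F ⊗ x 0F ⊕ V (x ∘ suc)
      row0-· x = cong₂ _⊕_ (cong (_⊗ x 0F) (row₀ 0F)) (Σ-cong λ j → cong (_⊗ x (suc j)) (row₀ (suc j)))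

      complement-· : ∀ y i → (complement M · y) i ≡ Σ' (λ j → M (suc i) (suc j) ⊗ y j) ⊕ ⊖ u i ⊗ V y
      complement-· y i = trans
        (Σ-cong λ j → solve 4 (λ a b c y → (a :+ b :* c) :* y := a :* y :+ b :* (c :* y)) refl (M (suc i) (suc j)) (⊖ u i) (v (suc j)) (y j))
        (trans (Σ-+ (λ j → M (suc i) (suc j) ⊗ y j) (λ j → ⊖ u i ⊗ (v (suc j) ⊗ y j)))
          (cong (_ ⊕_) (Σ-*ˡ (⊖ u i) (λ j → v (suc j) ⊗ y j))))

      row-combination : ∀ x i → (M · x) (suc i) ≡ (complement M · (x ∘ suc)) i ⊕ u i ⊗ (M · x) 0F
      row-combination x i = trans (cong (λ z → z ⊗ x 0F ⊕ a) (trans (col₀ (suc i)) (v≡v₀u i)))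
        (trans (identity (v 0F) (u i) (x 0F) a (V (x ∘ suc)))
          (sym (cong₂ (λ p q → p ⊕ u i ⊗ q) (complement-· (x ∘ suc) i) (row0-· x))))
        where
        a = Σ' λ j → M (suc i) (suc j) ⊗ x (suc j)
        identity : ∀ s u x a V → s ⊗ u ⊗ x ⊕ a ≡ (a ⊕ ⊖ u ⊗ V) ⊕ u ⊗ (s ⊗ x ⊕ V)
        identity = solve 5 (λ s u x a V → s :* u :* x :+ a := (a :+ :- u :* V) :+ u :* (s :* x :+ V)) refl

      lift : (Fin n → k) → Fin (suc n) → k
      lift y 0F      = ⊖ v₀⁻¹ ⊗ V y
      lift y (suc i) = y i

      row0-lift : ∀ y → (M · lift y) 0F ≡ 0#
      row0-lift y = trans (row0-· (lift y)) (trans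
        (solve 3 (λ a b s → a :* (:- b :* s) :+ s := (:1 :+ :- (a :* b)) :* s) refl (v 0F) v₀⁻¹ (V y))
        (trans (cong (_⊗ V y) (trans (cong (λ z → 1# ⊕ ⊖ z) v₀-inv) (-‿inverseʳ 1#))) (zeroˡ _)))

      a+ub≡a : ∀ {a b u : k} → b ≡ 0# → a ⊕ u ⊗ b ≡ a
      a+ub≡a {a} {u = u} refl = solve 2 (λ a u → a :+ u :* :0 := a) refl a u

      kernel-bijection : Bijection (vectors (suc n)) (vectors n) (Ker M) (Ker (complement M))
      kernel-bijection = record
        { to = _∘ suc
        ; from = lift
        ; to-cong = λ e → e ∘ suc
        ; from-cong = λ e → λ { 0F → cong (⊖ v₀⁻¹ ⊗_) (V-cong e) ; (suc i) → e i }
        ; to-mem = λ {x} kx i → trans (sym (a+ub≡a (kx 0F))) (trans (sym (row-combination x i)) (kx (suc i)))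
        ; from-mem = λ {y} ky → λ
          { 0F → row0-lift y
          ; (suc i) → trans (row-combination (lift y) i) (trans (a+ub≡a (row0-lift y)) (ky i)) }
        ; from∘to = λ {x} kx → λ
          { 0F → begin
              ⊖ v₀⁻¹ ⊗ V (x ∘ suc)
                ≡⟨ solve 4 (λ c V v x → :- c :* V := v :* c :* x :+ :- c :* (v :* x :+ V)) refl v₀⁻¹ (V (x ∘ suc)) (v 0F) (x 0F) ⟩
              v 0F ⊗ v₀⁻¹ ⊗ x 0F ⊕ ⊖ v₀⁻¹ ⊗ (v 0F ⊗ x 0F ⊕ V (x ∘ suc))
                ≡⟨ a+ub≡a (trans (sym (row0-· x)) (kx 0F)) ⟩
              v 0F ⊗ v₀⁻¹ ⊗ x 0F
                ≡⟨ trans (cong (_⊗ x 0F) v₀-inv) (*-identityˡ _) ⟩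
              x 0F ∎
          ; (suc i) → refl }
        ; to∘from = λ _ _ → refl }
        where open ≡-Reasoning

    module _ {F : Diagram (suc n)} (F-full : ∀ i j → F i j ≡ true) where

      no-support : ∀ {i j} {A : Set} → F i j ≡ false → A
      no-support {i} {j} e with trans (sym e) (F-full i j)
      ... | ()

      u-v-comm : ∀ i j → u i ⊗ v (suc j) ≡ u j ⊗ v (suc i)
      u-v-comm i j = solve 3 (λ a b c → a :* c :* b := b :* c :* a) refl (v (suc i)) (v (suc j)) v₀⁻¹

      -- On the full square the Schur complement of the corner can be any symmetric matrix of the
      -- same corank, and together with v it determines the matrix.
      count-schur-fibre : ∀ {c N} → Count (matrices n) (Good symmetric (λ i j → F (suc i) (suc j)) c) N →
                          Count (matrices (suc n)) (Fibre symmetric F c v) N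
      count-schur-fibre {c} = Count-map (reverse (record
        { to = complement ; from = build
        ; to-cong = λ e i j → cong (_⊕ _) (e (suc i) (suc j))
        ; from-cong = λ e → λ { 0F _ → refl ; (suc i) 0F → refl ; (suc i) (suc j) → cong (_⊕ _) (e i j) }
        ; to-mem = λ {M} f@(g , col) → record
            { transp = λ i j → trans (cong₂ _⊕_ (sym-M {c} {M} f (suc i) (suc j))
                (solve 3 (λ a b c → :- (a :* c) :* b := :- (b :* c) :* a) refl (v (suc i)) (v (suc j)) v₀⁻¹)) (sym (*-identityˡ _))
            ; diag = λ _ → tt ; supp = λ i j e → no-support e
            ; corank = Count-map (Kernel.kernel-bijection M (fibre-row₀ {c} {M} f) col) (corank g) }
        ; from-mem = λ {N} g → record
            { transp = λ
                { 0F 0F → sym (*-identityˡ _) ; 0F (suc j) → sym (*-identityˡ _) ; (suc i) 0F → sym (*-identityˡ _)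
                ; (suc i) (suc j) → trans (cong₂ _⊕_ (trans (transp g i j) (*-identityˡ _)) (u-v-comm i j)) (sym (*-identityˡ _)) }
            ; diag = λ _ → tt ; supp = λ i j e → no-support e
            ; corank = Count-map (reverse (Kernel.kernel-bijection (build N) (λ _ → refl) (build-col₀ N)))
                (Corank-cong {c = c} (λ i j → sym (complement-build N i j)) (corank g)) }
            , build-col₀ N
        ; from∘to = λ {M} f@(g , col) → λ
            { 0F j → sym (fibre-row₀ {c} {M} f j) ; (suc i) 0F → sym (col (suc i))
            ; (suc i) (suc j) → solve 3 (λ a b c → (a :+ :- b :* c) :+ b :* c := a) refl (M (suc i) (suc j)) (u i) (v (suc j)) }
        ; to∘from = λ {N} _ → complement-build N }))
        where
        sym-M : ∀ {c M} → Fibre symmetric F c v M → ∀ i j → M i j ≡ M j i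
        sym-M (g , _) i j = trans (transp g i j) (*-identityˡ _)
        fibre-row₀ : ∀ {c M} → Fibre symmetric F c v M → ∀ j → M 0F j ≡ v j
        fibre-row₀ {c} {M} f j = trans (sym-M {c} {M} f 0F j) (proj₂ f j)
        build-col₀ : ∀ N i → build N i 0F ≡ v i
        build-col₀ N 0F      = refl
        build-col₀ N (suc i) = refl

  -- Fibres over a given column 0

  Good-cong : ∀ {κ} {F G : Diagram n} {c M} → (∀ i j → F i j ≡ G i j) → Good κ F c M → Good κ G c M
  Good-cong eq g = record { Good g ; supp = λ i j e → Good.supp g i j (trans (eq i j) e) }

  -- `lift₀ ρ` fixes the index 0, so column 0 stays column 0 and only its entries are permuted.
  fibre-permute : ∀ {κ F c} {v : Fin (suc n) → k} (ρ : Permutation′ n) → let π = lift₀ ρ in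
    Bijection (matrices (suc n)) (matrices (suc n)) (Fibre κ F c v)
      (Fibre κ (λ i j → F (π ⟨$⟩ʳ i) (π ⟨$⟩ʳ j)) c (v ∘ (π ⟨$⟩ʳ_)))
  fibre-permute {F = F} {v = v} ρ = record
    { to = λ M i j → M (π ⟨$⟩ʳ i) (π ⟨$⟩ʳ j)
    ; from = λ M i j → M (π ⟨$⟩ˡ i) (π ⟨$⟩ˡ j)
    ; to-cong = λ e i j → e _ _ ; from-cong = λ e i j → e _ _
    ; to-mem = λ (g , col) → Good-permute π g , λ i → col (π ⟨$⟩ʳ i)
    ; from-mem = λ (g , col) →
        Good-cong (λ i j → cong₂ F (Perm.inverseʳ π) (Perm.inverseʳ π)) (Good-permute (Perm.flip π) g)
        , λ i → trans (col (π ⟨$⟩ˡ i)) (cong v (Perm.inverseʳ π))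
    ; from∘to = λ {M} _ i j → cong₂ M (Perm.inverseʳ π) (Perm.inverseʳ π)
    ; to∘from = λ {M} _ i j → cong₂ M (Perm.inverseˡ π) (Perm.inverseˡ π) }
    where π = lift₀ ρ

  Supported⇒true : ∀ {b : Fin n → Bool} {v i} → Supported b v → v i ≢ 0# → b i ≡ true
  Supported⇒true {b = b} {i = i} supp nz with b i in eq
  ... | true  = refl
  ... | false = ⊥-elim (nz (supp i eq))

  count-fibre : ∀ {m} κ {F : Diagram (2 + m)} {c v N} (p : Fin (suc m)) → Shape F →
    Supported (λ i → F i zero) v → v zero ≡ 0# → v (suc p) ≢ 0# →
    Count (matrices m) (Good κ (delete p (delete₀ F)) c) N →
    Count (matrices (2 + m)) (Fibre κ F c v) (Kind.#D κ * (q ^ m * N))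
  count-fibre κ {F} {c} {v} p S supp v₀ v≢0 cnt with inverse (v (suc p)) v≢0
  ... | v⁻¹ , inv = Count-map (reverse (fibre-permute (insert zero p Perm.id)))
    (Eliminate.count-pivot-fibre κ (v ∘ (π ⟨$⟩ʳ_)) v₀ v⁻¹ inv
      (λ i j → symm S (π ⟨$⟩ʳ i) (π ⟨$⟩ʳ j))
      -- A nonzero v i puts (i, 0) in F, and `up` then gives the whole row i.
      (λ i nz j → up S (Supported⇒true supp nz) ℕₚ.≤-refl z≤n) cnt)
    where
    -- This sends 1 to `suc p` and `suc (suc i)` to `suc (punchIn p i)`, so that removing the
    -- indices 0 and 1 yields `delete p (delete₀ F)`.
    π = lift₀ (insert zero p Perm.id)

  column₀ : Matrix (suc n) → Fin (suc n) → k
  column₀ M i = M i zero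

  -- Invertible matrices on the full square

  -- The number of invertible n×n matrices of a kind, without constraint on the support: σ is 1 if the
  -- corner entry can be a pivot and 0 if not, δ is the number of possible diagonal entries.
  full : ℕ → ℕ → ℕ → ℕ
  full σ δ zero          = 1
  full σ δ (suc zero)    = q⁻ * q ^ 0 * (σ * 1) + 1 * nz 0 * 0
  full σ δ (suc (suc m)) = q⁻ * q ^ suc m * (σ * full σ δ (suc m)) + 1 * nz (suc m) * (δ * (q ^ m * full σ δ m))

  ⊤-diagram : Diagram n
  ⊤-diagram _ _ = true

  ⊤-shape : Shape {n} ⊤-diagram
  ⊤-shape = record { symm = λ _ _ → refl ; up = λ _ _ _ → refl }

  module _ (κ : Kind) where
    open Kind κ

    count-columns : ∀ {F : Diagram (suc n)} {c m w} {B : (Fin (suc n) → k) → Set} →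
      (∀ {u v} → (∀ i → u i ≡ v i) → B u → B v) → Count (vectors (suc n)) B m →
      (∀ v → B v → Count (matrices (suc n)) (Fibre κ F c v) w) →
      Count (matrices (suc n)) (λ M → Good κ F c M × B (column₀ M)) (m * w)
    count-columns {n} {m = m} {w} B-resp b fib = subst (Count _ _) (sumℕ-const m w)
      (Count-fibre (matrices (suc n)) (vectors (suc n)) column₀ (λ e i → e i zero) b (λ _ → w)
        (λ j → Count-resp (matrices (suc n))
          (λ (g , col) → (g , B-resp (λ i → sym (col i)) (sound b j)) , col) (λ ((g , _) , col) → g , col)
          (fib (enum b j) (sound b j)))
        proj₂)

    count-empty-diagram : ∀ {F : Diagram 0} → Count (matrices 0) (Good κ F 0) 1
    count-empty-diagram = Count-single (matrices 0) (λ ())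
      (record { transp = λ () ; diag = λ () ; supp = λ ()
              ; corank = Count-resp (vectors 0) (λ _ ()) (λ _ → tt) (count-vectors 0) }) (λ _ ())

    -- Column 0 of an invertible matrix is nonzero. It has v₀ ≠ 0 in q⁻ q ^ n cases, and v₀ = 0 with
    -- a nonzero remainder in `nz n` cases.
    count-invertible : ∀ {w₁ w₂} →
      (∀ v → v zero ≢ 0# → Count (matrices (suc n)) (Fibre κ ⊤-diagram 0 v) w₁) →
      (∀ v → v zero ≡ 0# → Nonzero (v ∘ suc) → Count (matrices (suc n)) (Fibre κ ⊤-diagram 0 v) w₂) →
      Count (matrices (suc n)) (Good κ ⊤-diagram 0) (q⁻ * q ^ n * w₁ + 1 * nz n * w₂)
    count-invertible {n} fib₁ fib₂ = Count-resp (matrices (suc n))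
      [ proj₁ , proj₁ ]′ split
      (Count-⊎ (matrices (suc n)) (λ eq (_ , ne , _) (_ , e , _) → ne (trans (eq zero zero) e))
        (count-columns (λ e (ne , _) → (λ z → ne (trans (e zero) z)) , tt)
          (count-cons count-units (count-vectors n) _) (λ v (ne , _) → fib₁ v ne))
        (count-columns (λ e (z , i , ne) → trans (sym (e zero)) z , i , λ z′ → ne (trans (e (suc i)) z′))
          (count-cons count-zero (count-nonzero n) λ e (i , ne) → i , λ z → ne (trans (e i) z))
          (λ v (z , nonzero) → fib₂ v z nonzero)))
      where
      split : ∀ {M} → Good κ ⊤-diagram 0 M →
        (Good κ ⊤-diagram 0 M × M zero zero ≢ 0# × ⊤) ⊎
        (Good κ ⊤-diagram 0 M × M zero zero ≡ 0# × Nonzero (column₀ M ∘ suc))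
      split {M} g with M zero zero ≟ 0# | Nonzero? (column₀ M ∘ suc)
      ... | no ne | _      = inj₁ (g , ne , tt)
      ... | yes z | yes nz = inj₂ (g , z , nz)
      ... | yes z | no ¬nz = ⊥-elim (ZeroColumn.corank-≢0 κ {v = λ _ → 0#} (λ _ → refl) {M}
        (λ j → trans (Good.transp g zero j) (trans (cong (ε ⊗_) (col j)) (CommutativeRing.zeroʳ ring ε))) col (Good.corank g))
        where
        col : ∀ i → M i zero ≡ 0#
        col zero    = z
        col (suc i) = ¬Nonzero⇒0 ¬nz i

    -- The hypothesis on corners is the only point where the kinds differ in method: a Schur
    -- complement for symmetric matrices, an empty fibre for alternating ones.
    count-full : ∀ σ → (∀ {n w} (v : Fin (suc n) → k) → v zero ≢ 0# →
        Count (matrices n) (Good κ ⊤-diagram 0) w → Count (matrices (suc n)) (Fibre κ ⊤-diagram 0 v) (σ * w)) →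
      ∀ n → Count (matrices n) (Good κ ⊤-diagram 0) (full σ #D n)
    count-full σ corner zero          = count-empty-diagram
    count-full σ corner (suc zero)    = count-invertible
      {w₂ = 0} (λ v ne → corner v ne count-empty-diagram) (λ { _ _ (() , _) })
    count-full σ corner (suc (suc m)) = count-invertible
      (λ v ne → corner v ne (count-full σ corner (suc m)))
      (λ v z (p , ne) → count-fibre κ p ⊤-shape (λ _ ()) z ne (count-full σ corner m))

  count-full-symmetric : ∀ n → Count (matrices n) (Good symmetric ⊤-diagram 0) (full 1 q n)
  count-full-symmetric = count-full symmetric 1 corner
    where
    corner : ∀ {n w} (v : Fin (suc n) → k) → v zero ≢ 0# → Count (matrices n) (Good symmetric ⊤-diagram 0) w →
             Count (matrices (suc n)) (Fibre symmetric ⊤-diagram 0 v) (1 * w)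
    corner {w = w} v ne cnt with inverse (v zero) ne
    ... | v⁻¹ , inv = subst (Count _ _) (sym (ℕₚ.*-identityˡ w)) (Schur.count-schur-fibre v v⁻¹ inv (λ _ _ → refl) cnt)

  count-full-alternating : ∀ n → Count (matrices n) (Good alternating ⊤-diagram 0) (full 0 1 n)
  count-full-alternating = count-full alternating 0 λ v ne _ →
    Count-empty (matrices _) λ (g , col) → ne (trans (sym (col zero)) (Good.diag g zero))

  -- Comparing the two recursions

  private
    G H : ℕ → ℕ
    G = full 1 q
    H = full 0 1

  mutual
    -- By `full-even`, q q ^ (2t-1) G (2t-1) is G (2t). Both terms of the recursion for G (2t+1) are
    -- then multiples of G (2t), with coefficients adding up to `nz (suc (t * 2))`.
    full-odd : ∀ t → G (suc (t * 2)) ≡ nz (suc (t * 2)) * G (t * 2)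
    full-odd zero    = lemma q⁻ (nz 0)
      where
      lemma : ∀ x y → x * 1 * (1 * 1) + 1 * y * 0 ≡ (x * 1 + 1 * 0) * 1
      lemma = solve-∀
    full-odd (suc t) = begin
      q⁻ * q ^ (2 + 2t) * (1 * G (2 + 2t)) + 1 * nz (2 + 2t) * (q * (q ^ suc 2t * G (suc 2t)))
        ≡⟨ cong (λ z → q⁻ * q ^ (2 + 2t) * (1 * G (2 + 2t)) + 1 * nz (2 + 2t) * z)
             (trans (sym (ℕₚ.*-assoc q (q ^ suc 2t) (G (suc 2t)))) (sym (full-even t))) ⟩
      q⁻ * q ^ (2 + 2t) * (1 * G (2 + 2t)) + 1 * nz (2 + 2t) * G (2 + 2t)
        ≡⟨ lemma q⁻ (q ^ (2 + 2t)) (nz (2 + 2t)) (G (2 + 2t)) ⟩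
      (q⁻ * q ^ (2 + 2t) + 1 * nz (2 + 2t)) * G (2 + 2t) ∎
      where
      open ≡-Reasoning
      2t = t * 2
      lemma : ∀ x y z g → x * y * (1 * g) + 1 * z * g ≡ (x * y + 1 * z) * g
      lemma = solve-∀

    -- By `full-odd` the second term is q ^ (2t+1) G (2t+1), while the first is q⁻ times that; and
    -- q⁻ + 1 = q.
    full-even : ∀ t → G (2 + t * 2) ≡ q ^ (2 + t * 2) * G (suc (t * 2))
    full-even t = begin
      q⁻ * q ^ suc 2t * (1 * G (suc 2t)) + 1 * nz (suc 2t) * (q * (q ^ 2t * G 2t))
        ≡⟨ lemma₁ q⁻ q (q ^ 2t) (nz (suc 2t)) (G (suc 2t)) (G 2t) ⟩
      q⁻ * (q ^ suc 2t * G (suc 2t)) + q ^ suc 2t * (nz (suc 2t) * G 2t)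
        ≡⟨ cong (λ z → q⁻ * (q ^ suc 2t * G (suc 2t)) + q ^ suc 2t * z) (sym (full-odd t)) ⟩
      q⁻ * (q ^ suc 2t * G (suc 2t)) + q ^ suc 2t * G (suc 2t)
        ≡⟨ lemma₂ q⁻ (q ^ suc 2t) (G (suc 2t)) ⟩
      suc q⁻ * q ^ suc 2t * G (suc 2t)
        ≡⟨ cong (λ z → z * q ^ suc 2t * G (suc 2t)) suc-q⁻ ⟩
      q ^ (2 + 2t) * G (suc 2t) ∎
      where
      open ≡-Reasoning
      2t = t * 2
      lemma₁ : ∀ x y z w g h → x * (y * z) * (1 * g) + 1 * w * (y * (z * h)) ≡ x * (y * z * g) + y * z * (w * h)
      lemma₁ = solve-∀
      lemma₂ : ∀ x y g → x * (y * g) + y * g ≡ (1 + x) * y * g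
      lemma₂ = solve-∀

  -- From 2t to 2t + 2, G gains the factor q ^ (2t+2) nz (2t+1) and H the factor q ^ (2t) nz (2t+1),
  -- so their quotient gains q ^ 2.
  full-symmetric-alternating : ∀ t → G (t * 2) ≡ q ^ (t * 2) * H (t * 2)
  full-symmetric-alternating zero    = refl
  full-symmetric-alternating (suc t) = begin
    G (2 + 2t)                                           ≡⟨ full-even t ⟩
    q ^ (2 + 2t) * G (suc 2t)                             ≡⟨ cong (q ^ (2 + 2t) *_) (full-odd t) ⟩
    q ^ (2 + 2t) * (nz (suc 2t) * G 2t)                    ≡⟨ cong (λ z → q ^ (2 + 2t) * (nz (suc 2t) * z)) (full-symmetric-alternating t) ⟩
    q ^ (2 + 2t) * (nz (suc 2t) * (q ^ 2t * H 2t))          ≡⟨ lemma (q ^ (2 + 2t)) (nz (suc 2t)) (q ^ 2t) (H 2t) (q⁻ * q ^ suc 2t) (H (suc 2t)) ⟩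
    q ^ (2 + 2t) * (q⁻ * q ^ suc 2t * (0 * H (suc 2t)) + 1 * nz (suc 2t) * (1 * (q ^ 2t * H 2t))) ∎
    where
    open ≡-Reasoning
    2t = t * 2
    lemma : ∀ x w y h a b → x * (w * (y * h)) ≡ x * (a * (0 * b) + 1 * w * (1 * (y * h)))
    lemma = solve-∀

  -- Induction on the size of the diagram

  Balanced : {n : ℕ} → (Kind → Matrix n → Set) → ℕ → Set
  Balanced {n} P d = ∃ λ w → Count (matrices n) (P alternating) w × Count (matrices n) (P symmetric) (q ^ d * w)

  balanced-full : {F : Diagram n} → (∀ i j → F i j ≡ true) → Even n → Balanced (λ κ → Good κ F 0) (diagCells F)
  balanced-full {n} {F} all (divides t refl) = full 0 1 n ,
    Count-resp (matrices n) (Good-cong λ i j → sym (all i j)) (Good-cong all) (count-full-alternating n) ,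
    subst (Count _ _) (trans (full-symmetric-alternating t) (cong (λ z → q ^ z * full 0 1 n) (sym (countᵇ-all λ i → all i i))))
      (Count-resp (matrices n) (Good-cong λ i j → sym (all i j)) (Good-cong all) (count-full-symmetric n))

  BalancedAt : ℕ → Set
  BalancedAt n = ∀ (F : Diagram n) a b c → Shape F → Covered a b F → a + b + c ≡ n → Even (a + b) →
    Balanced (λ κ → Good κ F c) (diagCells F)

  balanced-pivot : ∀ {F : Diagram (suc n)} {a b c v} → Shape F → Covered a b F → a + b + c ≡ suc n → Even (a + b) →
    F zero zero ≡ false → Supported (λ i → F i zero) v → (p : Fin n) → v (suc p) ≢ 0# →
    (∀ {m} → m < suc n → BalancedAt m) → Balanced (λ κ → Fibre κ F c v) (diagCells F)
  balanced-pivot {suc m} {F} {a} {b} {c} {v} S C eq even F₀₀ supp p ne IH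
    with a′ , b′ , C′ , eq′ , a+b ← Covered-delete {F = F} p C eq (trans (symm S zero (suc p)) (Supported⇒true supp ne)) (Supported⇒true supp ne)
    with w , alt , sm ← IH (s≤s (ℕₚ.n≤1+n m)) (delete p (delete₀ F)) a′ b′ c
           (Shape-delete p (Shape-delete₀ S)) C′ eq′ (Even-2+ a+b even) =
    1 * (q ^ m * w) , count-fibre alternating p S supp (supp zero F₀₀) ne alt ,
    subst (Count _ _) (trans (lemma q (q ^ m) (q ^ d) w) (cong (λ z → q ^ z * (1 * (q ^ m * w))) (sym diag-delete)))
      (count-fibre symmetric p S supp (supp zero F₀₀) ne sm)
    where
    d = diagCells (delete p (delete₀ F))
    -- The deleted indices carry exactly one diagonal cell, as row `suc p` is full and (0, 0) is not
    -- in F. It matches the factor `#D`, which is q for symmetric and 1 for alternating matrices.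
    diag-delete : diagCells F ≡ suc d
    diag-delete rewrite F₀₀ | countᵇ-punchIn (λ i → F (suc i) (suc i)) p | up S {t = suc p} (Supported⇒true supp ne) ℕₚ.≤-refl z≤n = refl
    lemma : ∀ x y z w → x * (y * (z * w)) ≡ x * z * (1 * (y * w))
    lemma = solve-∀

  balanced-zero : ∀ {F : Diagram (suc n)} {a b v} c → Shape F → Covered a b F → a + b + c ≡ suc n → Even (a + b) →
    F zero zero ≡ false → (∀ i → v i ≡ 0#) →
    (∀ {m} → m < suc n → BalancedAt m) → Balanced (λ κ → Fibre κ F c v) (diagCells F)
  -- For corank 0 both fibres are empty, which satisfies any ratio.
  balanced-zero {F = F} zero S C eq even F₀₀ v-0 IH = 0 , ZeroColumn.count-zero-fibre-invertible alternating v-0 ,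
    subst (Count _ _) (sym (ℕₚ.*-zeroʳ (q ^ diagCells F))) (ZeroColumn.count-zero-fibre-invertible symmetric v-0)
  -- Size and corank both drop by one, so a and b stay the same; as (0, 0) is not in F, no diagonal
  -- cell is lost.
  balanced-zero {n} {F} {a} {b} (suc c) S C eq even F₀₀ v-0 IH
    with w , alt , sm ← IH ℕₚ.≤-refl (delete₀ F) a b c (Shape-delete₀ S) (Covered-delete₀ {F = F} C)
           (ℕₚ.suc-injective (trans (sym (ℕₚ.+-suc (a + b) c)) eq)) even
    rewrite F₀₀ =
    w , ZeroColumn.count-zero-fibre alternating v-0 alt , ZeroColumn.count-zero-fibre symmetric v-0 sm

  balanced : ∀ n → BalancedAt n
  balanced = <-rec BalancedAt step
    where
    step : ∀ n → (∀ {m} → m < n → BalancedAt m) → BalancedAt n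
    step zero    IH F zero zero zero S C eq even = 1 , count-empty-diagram alternating , count-empty-diagram symmetric
    step (suc n) IH F a b c S C eq even with F zero zero Boolₚ.≟ true
    ... | yes F₀₀ = subst (λ c → Balanced (λ κ → Good κ F c) (diagCells F)) (sym c≡0)
                   (balanced-full (λ i j → up S F₀₀ z≤n z≤n) (subst Even a+b≡n even))
      where
      -- The index 0 is covered only if a or b alone is the whole size.
      n≤a+b : suc n ≤ a + b
      n≤a+b = [ (λ le → ℕₚ.≤-trans le (ℕₚ.+-monoʳ-≤ a z≤n))
              , (λ le → ℕₚ.≤-trans le (ℕₚ.≤-trans (ℕₚ.≤-reflexive (ℕₚ.+-identityʳ b)) (ℕₚ.m≤n+m b a))) ]′ (C zero zero F₀₀)
      a+b≡n : a + b ≡ suc n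
      a+b≡n = ℕₚ.≤-antisym (ℕₚ.≤-trans (ℕₚ.m≤m+n _ c) (ℕₚ.≤-reflexive eq)) n≤a+b
      c≡0 : c ≡ 0
      c≡0 = ℕₚ.+-cancelˡ-≡ (a + b) c 0 (trans eq (sym (trans (ℕₚ.+-identityʳ _) a+b≡n)))
    ... | no ¬F₀₀ = sumℕ w , total alternating w (λ j → proj₁ (proj₂ (fibre j))) ,
      subst (Count _ _) (sumℕ-*ˡ (q ^ diagCells F) w) (total symmetric (λ j → q ^ diagCells F * w j) (λ j → proj₂ (proj₂ (fibre j))))
      where
      F₀₀ = Boolₚ.¬-not ¬F₀₀
      -- The possible columns 0 are enumerated once for both kinds, so that the fibres can be
      -- compared one by one.
      columns = count-supported (λ i → F i zero)
      fibre : ∀ j → Balanced (λ κ → Fibre κ F c (enum columns j)) (diagCells F)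
      fibre j with Nonzero? (enum columns j)
      ... | no ¬nz           = balanced-zero {F = F} {a} {b} c S C eq even F₀₀ (¬Nonzero⇒0 ¬nz) IH
      ... | yes (zero  , ne) = ⊥-elim (ne (sound columns j zero F₀₀))
      ... | yes (suc p , ne) = balanced-pivot {F = F} {a} {b} S C eq even F₀₀ (sound columns j) p ne IH
      w : Fin (q ^ countᵇ (λ i → F i zero)) → ℕ
      w j = proj₁ (fibre j)
      total : ∀ κ w → (∀ j → Count (matrices (suc n)) (Fibre κ F c (enum columns j)) (w j)) →
              Count (matrices (suc n)) (Good κ F c) (sumℕ w)
      total κ w fib = Count-fibre (matrices (suc n)) (vectors (suc n)) column₀ (λ e i → e i zero) columns w fib
        (λ g i e → Good.supp g i zero e)

  -- Return to ranks and to the original indices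

  HasKind : (κ : Kind) → Mat n → Set
  HasKind κ M = (∀ i j → M [ i , j ] ≡ Kind.ε κ ⊗ M [ j , i ]) × (∀ i → Kind.D κ (M [ i , i ]))

  fromEntries : Matrix n → Mat n
  fromEntries N = tabulate λ i → tabulate (N i)

  entries-fromEntries : ∀ (N : Matrix n) i j → fromEntries N [ i , j ] ≡ N i j
  entries-fromEntries N i j = trans (cong (λ row → lookup row j) (Vecₚ.lookup∘tabulate _ i)) (Vecₚ.lookup∘tabulate (N i) j)

  fromEntries-cong : {N N′ : Matrix n} → (∀ i j → N i j ≡ N′ i j) → fromEntries N ≡ fromEntries N′
  fromEntries-cong e = Vecₚ.tabulate-cong λ i → Vecₚ.tabulate-cong (e i)

  fromEntries-entries : (M : Mat n) → fromEntries (entries M) ≡ M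
  fromEntries-entries M = trans (Vecₚ.tabulate-cong λ i → Vecₚ.tabulate∘lookup (lookup M i)) (Vecₚ.tabulate∘lookup M)

  -- Reversing the indices is a simultaneous permutation of rows and columns, so it keeps the kind
  -- and the corank, and rank r corresponds to corank n - r.
  rotation-bijection : ∀ κ (F : Diagram n) {c r} → c + r ≡ n → Bijection (≡.setoid (Mat n)) (matrices n)
    (λ M → HasKind κ M × SupportIn F M × HasRank M r) (Good κ (rotate F) c)
  rotation-bijection {n} κ F {c} {r} c+r≡n = record
    { to = to
    ; from = from
    ; to-cong = λ { refl _ _ → refl }
    ; from-cong = λ e → fromEntries-cong λ i j → e _ _
    ; to-mem = λ {M} ((tr , dg) , supp , R) → record
        { transp = λ i j → tr _ _ ; diag = λ i → dg _ ; supp = λ i j → off-support {M} supp (opposite i) (opposite j)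
        ; corank = Corank-permute Perm.reverse {c = c} (rank⇒corank M R c+r≡n) }
    ; from-mem = λ {N} g →
        let e = entries-from N in
        ( (λ i j → trans (e i j) (trans (Good.transp g _ _) (cong (Kind.ε κ ⊗_) (sym (e j i)))))
        , (λ i → subst (Kind.D κ) (sym (e i i)) (Good.diag g _)))
        , (λ i j ne → on-support i j λ F≡f → ne (trans (e i j) (Good.supp g _ _ (trans (cong₂ F (opp² i) (opp² j)) F≡f))))
        , corank⇒rank (from N) (Corank-cong {c = c} (λ i j → sym (e i j)) (Corank-permute Perm.reverse {c = c} (Good.corank g))) c+r≡n
    ; from∘to = λ {M} _ → trans (fromEntries-cong λ i j → cong₂ (entries M) (opp² i) (opp² j)) (fromEntries-entries M)
    ; to∘from = λ {N} _ i j → trans (entries-from N _ _) (cong₂ N (opp² i) (opp² j)) }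
    where
    opp² : ∀ (i : Fin n) → opposite (opposite i) ≡ i
    opp² = Finₚ.opposite-involutive
    to : Mat n → Matrix n
    to M i j = M [ opposite i , opposite j ]
    from : Matrix n → Mat n
    from N = fromEntries λ i j → N (opposite i) (opposite j)
    entries-from : ∀ N i j → from N [ i , j ] ≡ N (opposite i) (opposite j)
    entries-from N = entries-fromEntries λ i j → N (opposite i) (opposite j)
    off-support : ∀ {M} → SupportIn F M → ∀ i j → F i j ≡ false → M [ i , j ] ≡ 0#
    off-support {M} supp i j F≡f with M [ i , j ] ≟ 0#
    ... | yes z = z
    ... | no ne with trans (sym F≡f) (supp i j ne)
    ...   | ()
    on-support : ∀ i j → ¬ F i j ≡ false → F i j ≡ true
    on-support i j ¬F≡f with F i j
    ... | true  = refl
    ... | false = ⊥-elim (¬F≡f refl)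

  count-Alt : ∀ {F : Diagram n} {c r w} → c + r ≡ n → HasCount (AltRankIn F r) w →
              Count (matrices n) (Good alternating (rotate F) c) w
  count-Alt {F = F} eq h = Count-map (rotation-bijection alternating F eq) (Count-resp (≡.setoid _)
    (λ ((z , tr) , s) → ((λ i j → trans (tr i j) (sym (-1*x≈-x _))) , z) , s)
    (λ ((tr , z) , s) → (z , λ i j → trans (tr i j) (-1*x≈-x _)) , s) (HasCount⇒Count h))

  count-Sym : ∀ {F : Diagram n} {c r w} → c + r ≡ n → HasCount (SymRankIn F r) w →
              Count (matrices n) (Good symmetric (rotate F) c) w
  count-Sym {F = F} eq h = Count-map (rotation-bijection symmetric F eq) (Count-resp (≡.setoid _)
    (λ (tr , s) → ((λ i j → trans (tr i j) (sym (*-identityˡ _))) , _) , s)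
    (λ ((tr , _) , s) → (λ i j → trans (tr i j) (*-identityˡ _)) , s) (HasCount⇒Count h))

  count-rank>n : ∀ {P : Mat n → Set} {r w} → (∀ {M} → P M → HasRank M r) → ¬ r ≤ n → HasCount P w → w ≡ 0
  count-rank>n R r≰n h = Count-unique (≡.setoid _) id id (HasCount⇒Count h)
    (Count-empty (≡.setoid _) λ {M} p → r≰n (rank-≤ M (R p)))

theorem5p2 : (q : ℕ) → IsPrimePower q → (K : FiniteField q) →
    (n : ℕ) → 1 ≤ n → (ℓ : ℕ) → (d : Vec ℕ ℓ) → IsSymmetricFerrersSeq d →
    (F : Diagram n) → IsFerrers F → IsSymmetricDiagram F →
    HasDiagonalSequence F d → Even (∂ d) →
    (wAlt wSym : ℕ) →
    HasCount (Matrices.AltRankIn K F (∂ d)) wAlt →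
    HasCount (Matrices.SymRankIn K F (∂ d)) wSym →
    q ^ diagCells F * wAlt ≡ wSym
theorem5p2 q _ K n _ ℓ d _ F ferrers sym-F sizes even wAlt wSym alt sm with ∂ d ℕ.≤? n
-- No n×n matrix has rank above n, so both counts are 0.
... | no ∂≰n = trans (cong (q ^ diagCells F *_) (count-rank>n (proj₂ ∘ proj₂) ∂≰n alt))
  (trans (ℕₚ.*-zeroʳ (q ^ diagCells F)) (sym (count-rank>n (proj₂ ∘ proj₂) ∂≰n sm)))
  where open OverField K
-- The induction is entered with a + b = ∂ d and corank n - ∂ d.
... | yes ∂≤n with a , b , a+b≡∂ , C ← cover d F ferrers sizes
  with w , alt′ , sm′ ← OverField.balanced K n (rotate F) a b (n ∸ ∂ d) (rotate-shape ferrers sym-F)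
         (rotate-covered {F = F} C) (trans (cong (_+ (n ∸ ∂ d)) a+b≡∂) (ℕₚ.m+[n∸m]≡n ∂≤n)) (subst Even (sym a+b≡∂) even) =
  begin
    -- Reversal maps the main diagonal to itself, so the number of its cells in F is unchanged.
    q ^ diagCells F * wAlt           ≡⟨ cong₂ (λ x y → q ^ x * y) (sym (countᵇ-permute (λ i → F i i) Perm.reverse))
                                          (Count-unique _ id id (count-Alt (ℕₚ.m∸n+n≡m ∂≤n) alt) alt′) ⟩
    q ^ diagCells (rotate F) * w     ≡⟨ Count-unique _ id id sm′ (count-Sym (ℕₚ.m∸n+n≡m ∂≤n) sm) ⟩
    wSym                             ∎
  where
  open OverField K
  open ≡-Reasoning
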